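{- $C_3$-Packing-T admits a polynomial kernel with $\mathcal O(m)$ vertices, where $m$ is the number of arcs in a given feedback arc set of the input. That is, there is a polynomial-time algorithm which, given a tournament $\mathcal T$, an integer $k$ and a feedback arc set of $\mathcal T$ with $m$ arcs, outputs an instance $(\mathcal T',k')$ of $C_3$-Packing-T such that $\mathcal T'$ has $\mathcal O(m)$ vertices and $(\mathcal T',k')$ is positive if and only if $(\mathcal T,k)$ is positive.
   Context: A tournament is an orientation of a complete graph. A triangle is a directed 3-cycle. A feedback arc set of a tournament is a set of arcs meeting every directed cycle. In the decision problem $C_3$-Packing-T, an instance is a pair $(\mathcal T,k)$ where $\mathcal T$ is a tournament and $k$ an integer; it is positive iff there exists a set of $k$ pairwise vertex-disjoint triangles in $\mathcal T$. A kernel is a polynomial-time algorithm mapping each instance to an equivalent instance of size bounded by a function of the parameter. -}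

module Defs where

open import Data.Bool.Base using (Bool; true; false; T)
open import Data.Fin.Base using (Fin; toℕ)
open import Data.Integer.Base using (ℤ; +_; -[1+_])
open import Data.List.Base using (List; []; _∷_; _∷ʳ_; zip; length; foldr; replicate; allFin)
open import Data.List.Membership.Propositional using (_∈_)
open import Data.List.Relation.Binary.Disjoint.Propositional using (Disjoint)
open import Data.List.Relation.Unary.All using (All)
open import Data.List.Relation.Unary.AllPairs using (AllPairs)
open import Data.List.Relation.Unary.Any using (Any)
open import Data.List.Relation.Unary.Unique.Propositional using (Unique)
open import Data.Nat.Base using (ℕ; _+_; _*_; _^_; _≤_)
open import Data.Nat.Binary.Base using (ℕᵇ; 2[1+_]; 1+[2_]; fromℕ)
  renaming (zero to 0ᵇ)
open import Data.Product.Base using (Σ-syntax; ∃-syntax; _×_; _,_; uncurry)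
open import Function.Base using (_∘_)
open import Relation.Binary.Definitions using (Trichotomous)
open import Relation.Binary.PropositionalEquality.Core using (_≡_)

-- Trichotomy says that exactly one of i ⟶ j, i ≡ j, j ⟶ i holds.

record Tournament (n : ℕ) : Set where
  field
    arc : Fin n → Fin n → Bool

  _⟶_ : Fin n → Fin n → Set
  i ⟶ j = T (arc i j)

  field
    compare : Trichotomous _≡_ _⟶_

module _ {n : ℕ} (𝒯 : Tournament n) where
  open Tournament 𝒯

  record Triangle : Set where
    field
      a b c : Fin n
      a⟶b   : a ⟶ b
      b⟶c   : b ⟶ c
      c⟶a   : c ⟶ a

    vertices : List (Fin n)
    vertices = a ∷ b ∷ c ∷ []

  VertexDisjoint : Triangle → Triangle → Set
  VertexDisjoint t u = Disjoint (Triangle.vertices t) (Triangle.vertices u)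

  record DirectedCycle : Set where
    field
      start : Fin n
      rest  : List (Fin n)

    -- The arcs v₀v₁, v₁v₂, …, vₗv₀ of the cycle v₀ v₁ … vₗ.
    cycleArcs : List (Fin n × Fin n)
    cycleArcs = zip (start ∷ rest) (rest ∷ʳ start)

    field
      distinct : Unique (start ∷ rest)
      areArcs  : All (uncurry _⟶_) cycleArcs

  record FeedbackArcSet : Set where
    field
      arcs    : List (Fin n × Fin n)
      unique  : Unique arcs
      areArcs : All (uncurry _⟶_) arcs
      meets   : (C : DirectedCycle) → Any (_∈ arcs) (DirectedCycle.cycleArcs C)

record Instance : Set where
  field
    order      : ℕ
    tournament : Tournament order
    target     : ℤ

-- Triangles that are pairwise vertex-disjoint are pairwise distinct, so
-- the list represents a set with that many elements.

Positive : Instance → Set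
Positive I = Σ[ ts ∈ List (Triangle tournament) ]
  AllPairs (VertexDisjoint tournament) ts × + length ts ≡ target
  where open Instance I

record InstanceWithFAS : Set where
  field
    base : Instance
    fas  : FeedbackArcSet (Instance.tournament base)

  parameter : ℕ
  parameter = length (FeedbackArcSet.arcs fas)

-- Programs are those of a WHILE language on binary trees (after Jones,
-- "Computability and Complexity"), written without variables: a program
-- transforms a single tree, in which several values can be paired.

data Tree : Set where
  leaf : Tree
  node : Tree → Tree → Tree

size : Tree → ℕ
size leaf       = 1
size (node l r) = 1 + size l + size r

data Program : Set where
  skip  : Program
  nil   : Program
  left  : Program
  right : Program
  pair  : Program → Program → Program
  _⨾_   : Program → Program → Program
  if    : Program → Program → Program → Program
  while : Program → Program → Program

infix  4 _on_⇓_cost_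
infixr 5 _⨾_

-- p on x ⇓ y cost t: program p, run on x, halts with result y in time t.
-- Every construct is charged the size of the tree it is run on.  The size
-- of each result is therefore at most the time spent, and this notion of
-- time agrees with that of Turing machines up to a polynomial.  The value
-- leaf of a test means false, any other value means true.

data _on_⇓_cost_ : Program → Tree → Tree → ℕ → Set where
  skip       : ∀ {x} → skip on x ⇓ x cost size x
  nil        : ∀ {x} → nil on x ⇓ leaf cost size x
  left-leaf  : left on leaf ⇓ leaf cost size leaf
  left-node  : ∀ {l r} → left on node l r ⇓ l cost size (node l r)
  right-leaf : right on leaf ⇓ leaf cost size leaf
  right-node : ∀ {l r} → right on node l r ⇓ r cost size (node l r)
  pair       : ∀ {p q x y z s t} →
               p on x ⇓ y cost s → q on x ⇓ z cost t →
               pair p q on x ⇓ node y z cost (size x + s + t)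
  seq        : ∀ {p q x y z s t} →
               p on x ⇓ y cost s → q on y ⇓ z cost t →
               (p ⨾ q) on x ⇓ z cost (size x + s + t)
  if-true    : ∀ {c p q x l r y s t} →
               c on x ⇓ node l r cost s → p on x ⇓ y cost t →
               if c p q on x ⇓ y cost (size x + s + t)
  if-false   : ∀ {c p q x y s t} →
               c on x ⇓ leaf cost s → q on x ⇓ y cost t →
               if c p q on x ⇓ y cost (size x + s + t)
  while-stop : ∀ {c p x s} →
               c on x ⇓ leaf cost s →
               while c p on x ⇓ x cost (size x + s)
  while-step : ∀ {c p x l r y z s t u} →
               c on x ⇓ node l r cost s → p on x ⇓ y cost t →
               while c p on y ⇓ z cost u →
               while c p on x ⇓ z cost (size x + s + t + u)

_IsPolynomiallyBoundedIn_ : {A : Set} → (A → ℕ) → (A → ℕ) → Set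
g IsPolynomiallyBoundedIn h = ∃[ c ] ∃[ d ] ∀ a → g a ≤ c * h a ^ d + c

PolynomialTime : {A B : Set} → (A → Tree) → (B → Tree) → (A → B) → Set
PolynomialTime {A} encodeA encodeB f =
  Σ[ p ∈ Program ] Σ[ time ∈ (A → ℕ) ]
    (∀ a → p on encodeA a ⇓ encodeB (f a) cost time a) ×
    time IsPolynomiallyBoundedIn (size ∘ encodeA)

-- A tournament is encoded by its adjacency matrix.  Vertices may be
-- written in unary since the matrix already has n² entries; the target,
-- which can be arbitrarily large compared to n, is written in binary.

encodeBool : Bool → Tree
encodeBool false = leaf
encodeBool true  = node leaf leaf

encodeList : {A : Set} → (A → Tree) → List A → Tree
encodeList encode = foldr (λ a t → node (encode a) t) leaf

encodeVertex : ∀ {n} → Fin n → Tree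
encodeVertex i = encodeList encodeBool (replicate (toℕ i) false)

encodeTournament : ∀ {n} → Tournament n → Tree
encodeTournament {n} 𝒯 =
  encodeList (λ i → encodeList (λ j → encodeBool (arc i j)) (allFin n)) (allFin n)
  where open Tournament 𝒯

-- Bijective base 2, least significant digit first: 1+[2 b ] has lowest
-- digit 1, and 2[1+ b ] has lowest digit 2.

encodeBinary : ℕᵇ → Tree
encodeBinary 0ᵇ       = leaf
encodeBinary 1+[2 b ] = node (encodeBool false) (encodeBinary b)
encodeBinary 2[1+ b ] = node (encodeBool true) (encodeBinary b)

encodeℤ : ℤ → Tree
encodeℤ (+ n)    = node (encodeBool false) (encodeBinary (fromℕ n))
encodeℤ -[1+ n ] = node (encodeBool true) (encodeBinary (fromℕ n))

encodeInstance : Instance → Tree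
encodeInstance I = node (encodeTournament tournament) (encodeℤ target)
  where open Instance I

encodeInstanceWithFAS : InstanceWithFAS → Tree
encodeInstanceWithFAS I =
  node (encodeInstance base)
       (encodeList (λ (i , j) → node (encodeVertex i) (encodeVertex j))
                   (FeedbackArcSet.arcs fas))
  where open InstanceWithFAS I

{-# OPTIONS --safe #-}

-- A vertex is free if it is not an endpoint of an arc of the feedback arc set
-- A.  Every triangle contains an arc of A, so it has at most one free vertex,
-- and then the arc between its other two vertices is in A: triangles with a
-- free vertex v are the pairs of an arc u ⟶ w in A and a free v with w ⟶ v ⟶ u.
-- Ranking each vertex by the number of its free in-neighbours turns the set of
-- these v into an interval of the free vertices.  Hence the greedy algorithm
-- for interval scheduling applies: the arcs of A, by increasing rank of their
-- tail, each select the first suitable free vertex that is still available,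
-- and an exchange argument turns any packing into one of the same size all of
-- whose free vertices are selected.  Keeping the endpoints and the selected
-- vertices leaves at most 3|A| vertices.  A target too large to be written
-- with that many binary digits is replaced by −1.

module Submission where

open import Defs
open import Data.Bool.Base using (Bool; true; false; T; not; _∧_; _∨_; if_then_else_)
open import Data.Bool.ListAction using (any)
open import Data.Bool.Properties using (T-∧; T-∨; T?)
open import Data.Empty using (⊥-elim)
open import Data.Fin.Base using (Fin; zero; suc; toℕ)
open import Data.Fin.Properties using (_≟_; toℕ-injective; any?; injective⇒≤)
open import Data.Integer.Base using (ℤ; -[1+_]) renaming (+_ to pos)
open import Data.List.Base using (List; []; _∷_; _++_; _ʳ++_; reverse; length; map; foldr; replicate; allFin; tabulate; filterᵇ; take; drop; lookup; null; head)
open import Data.List.Membership.DecPropositional as DecMembership using ()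
open import Data.List.Membership.Propositional using (_∈_; _∉_; find; lose)
open import Data.List.Membership.Propositional.Properties using (∈-filter⁺; ∈-filter⁻; ∈-++⁺ˡ; ∈-++⁺ʳ; ∈-++⁻; ∈-map⁺; ∈-map⁻; ∈-allFin; ∈-lookup)
open import Data.List.Properties using (reverse-involutive; ++-is-foldr; map-is-foldr; map-tabulate; length-map; length-++; length-replicate; length-tabulate; tabulate-lookup)
open import Data.List.Relation.Binary.Subset.Propositional using (_⊆_)
open import Data.List.Relation.Unary.All as All using (All; []; _∷_)
open import Data.List.Relation.Unary.AllPairs as AllPairs using (AllPairs; []; _∷_)
import Data.List.Relation.Unary.AllPairs.Properties as AllPairsₚ
open import Data.List.Relation.Unary.Any as Any using (Any; here; there; index)
open import Data.List.Relation.Unary.Any.Properties using (any⁺; any⁻; lookup-index)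
open import Data.List.Relation.Unary.Unique.Propositional using (Unique)
import Data.List.Relation.Unary.Unique.Propositional.Properties as Uniqueₚ
open import Data.Maybe.Base using (fromMaybe)
open import Data.Nat.Base using (ℕ; zero; suc; _+_; _*_; _^_; _≤_; _<_; z≤n; s≤s; _≤ᵇ_)
open import Data.Nat.Binary.Base using (ℕᵇ; 2[1+_]; 1+[2_]; fromℕ) renaming (zero to 0ᵇ; toℕ to toℕᵇ)
open import Data.Nat.Binary.Properties using (toℕ-fromℕ)
open import Data.Nat.Properties hiding (_≟_)
open import Data.Nat.Tactic.RingSolver using (solve-∀)
open import Data.Product.Base using (Σ-syntax; ∃-syntax; _×_; _,_; proj₁; proj₂)
open import Data.Product.Properties using (≡-dec)
open import Data.Sum.Base using (_⊎_; inj₁; inj₂; [_,_]′)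
open import Function.Base using (_∘_; id)
open import Function.Bundles using (Equivalence; _⇔_; mk⇔)
open import Relation.Binary.Definitions using (Symmetric; Tri; tri<; tri≈; tri>)
open import Relation.Binary.PropositionalEquality
open import Relation.Nullary using (¬_; contradiction; Dec; yes; no; does; ¬?; _×-dec_)
open import Relation.Nullary.Decidable.Core using (decidable-stable)

-- Polynomial bounds

infixl 6 _⊕_
infixl 7 _⊛_
infixr 9 _∘ₚ_

-- Bounds are kept as syntax, so that they follow the structure of a program. Composition is
-- included because a program that runs second gets the result of the first as its input.
data Poly : Set where
  con  : ℕ → Poly
  var  : Poly
  _⊕_  : Poly → Poly → Poly
  _⊛_  : Poly → Poly → Poly
  _∘ₚ_ : Poly → Poly → Poly

eval : Poly → ℕ → ℕ
eval (con c)  n = c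
eval var      n = n
eval (p ⊕ q)  n = eval p n + eval q n
eval (p ⊛ q)  n = eval p n * eval q n
eval (p ∘ₚ q) n = eval p (eval q n)

eval-mono : ∀ p {m n} → m ≤ n → eval p m ≤ eval p n
eval-mono (con c)  m≤n = ≤-refl
eval-mono var      m≤n = m≤n
eval-mono (p ⊕ q)  m≤n = +-mono-≤ (eval-mono p m≤n) (eval-mono q m≤n)
eval-mono (p ⊛ q)  m≤n = *-mono-≤ (eval-mono p m≤n) (eval-mono q m≤n)
eval-mono (p ∘ₚ q) m≤n = eval-mono p (eval-mono q m≤n)

^-distribʳ-* : ∀ m n o → (m * n) ^ o ≡ m ^ o * n ^ o
^-distribʳ-* m n zero    = refl
^-distribʳ-* m n (suc o) rewrite ^-distribʳ-* m n o =
  [m*n]*[o*p]≡[m*o]*[n*p] m n (m ^ o) (n ^ o)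

-- At positive arguments powers grow with the exponent, so the terms of a sum can be raised to a
-- common exponent.
monomial-bound : ∀ p → ∃[ c ] ∃[ d ] ∀ n → eval p (suc n) ≤ c * suc n ^ d
monomial-bound (con c) = c , 0 , λ n → ≤-reflexive (sym (*-identityʳ c))
monomial-bound var     = 1 , 1 , λ n → ≤-reflexive (sym (trans (*-identityˡ _) (*-identityʳ _)))
monomial-bound (p ⊕ q) with monomial-bound p | monomial-bound q
... | c , d , p≤ | c′ , d′ , q≤ = c + c′ , d + d′ , λ n → begin
  eval p (suc n) + eval q (suc n)             ≤⟨ +-mono-≤ (p≤ n) (q≤ n) ⟩
  c * suc n ^ d + c′ * suc n ^ d′             ≤⟨ +-mono-≤
    (*-monoʳ-≤ c (^-monoʳ-≤ (suc n) (m≤m+n d d′)))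
    (*-monoʳ-≤ c′ (^-monoʳ-≤ (suc n) (m≤n+m d′ d))) ⟩
  c * suc n ^ (d + d′) + c′ * suc n ^ (d + d′) ≡⟨ *-distribʳ-+ (suc n ^ (d + d′)) c c′ ⟨
  (c + c′) * suc n ^ (d + d′)                 ∎
  where open ≤-Reasoning
monomial-bound (p ⊛ q) with monomial-bound p | monomial-bound q
... | c , d , p≤ | c′ , d′ , q≤ = c * c′ , d + d′ , λ n → begin
  eval p (suc n) * eval q (suc n)       ≤⟨ *-mono-≤ (p≤ n) (q≤ n) ⟩
  (c * suc n ^ d) * (c′ * suc n ^ d′)   ≡⟨ [m*n]*[o*p]≡[m*o]*[n*p] c (suc n ^ d) c′ (suc n ^ d′) ⟩
  (c * c′) * (suc n ^ d * suc n ^ d′)   ≡⟨ cong (c * c′ *_) (^-distribˡ-+-* (suc n) d d′) ⟨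
  (c * c′) * suc n ^ (d + d′)           ∎
  where open ≤-Reasoning
monomial-bound (p ∘ₚ q) with monomial-bound p | monomial-bound q
... | c , d , p≤ | c′ , d′ , q≤ = c * suc c′ ^ d , d′ * d , λ n → begin
  eval p (eval q (suc n))                 ≤⟨ eval-mono p (n≤1+n _) ⟩
  eval p (suc (eval q (suc n)))           ≤⟨ p≤ _ ⟩
  -- The `suc` is absorbed into the coefficient `suc c′`, since `suc n ^ d′` is at least 1.
  c * suc (eval q (suc n)) ^ d            ≤⟨ *-monoʳ-≤ c (^-monoˡ-≤ d (+-mono-≤ (m^n>0 (suc n) d′) (q≤ n))) ⟩
  c * (suc c′ * suc n ^ d′) ^ d           ≡⟨ cong (c *_) (^-distribʳ-* (suc c′) (suc n ^ d′) d) ⟩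
  c * (suc c′ ^ d * (suc n ^ d′) ^ d)     ≡⟨ cong (λ z → c * (suc c′ ^ d * z)) (^-*-assoc (suc n) d′ d) ⟩
  c * (suc c′ ^ d * suc n ^ (d′ * d))     ≡⟨ *-assoc c _ _ ⟨
  c * suc c′ ^ d * suc n ^ (d′ * d)       ∎
  where open ≤-Reasoning

poly-bounded : ∀ {A : Set} p (g h : A → ℕ) → (∀ a → g a ≤ eval p (h a)) → g IsPolynomiallyBoundedIn h
poly-bounded p g h g≤ with monomial-bound p
... | c , d , p≤ = c , d , λ a → ≤-trans (g≤ a) (bound (h a))
  where
  bound : ∀ n → eval p n ≤ c * n ^ d + c
  -- The monomial may vanish at 0; the additive constant takes care of this argument.
  bound zero    = begin
    eval p 0           ≤⟨ eval-mono p z≤n ⟩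
    eval p 1           ≤⟨ p≤ 0 ⟩
    c * 1 ^ d          ≡⟨ cong (c *_) (^-zeroˡ d) ⟩
    c * 1              ≡⟨ *-identityʳ c ⟩
    c                  ≤⟨ m≤n+m c _ ⟩
    c * 0 ^ d + c      ∎
    where open ≤-Reasoning
  bound (suc n) = ≤-trans (p≤ n) (m≤m+n _ c)

-- Running times of programs

record Runs (p : Program) (β : Poly) (x y : Tree) : Set where
  constructor runs
  field
    {cost} : ℕ
    exec   : p on x ⇓ y cost cost
    cost≤  : cost ≤ eval β (size x)

-- Every construct pays for the tree it is run on, so even `skip` pays for its result. This is what
-- lets time bounds compose: intermediate results are no larger than the time already spent.
size-result≤cost : ∀ {p x y t} → p on x ⇓ y cost t → size y ≤ t
size-result≤cost skip = ≤-refl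
size-result≤cost {x = leaf} nil = ≤-refl
size-result≤cost {x = node _ _} nil = s≤s z≤n
size-result≤cost left-leaf = ≤-refl
size-result≤cost (left-node {l}) = m≤n⇒m≤1+n (m≤m+n (size l) _)
size-result≤cost right-leaf = ≤-refl
size-result≤cost (right-node {l} {r}) = m≤n⇒m≤1+n (m≤n+m (size r) (size l))
size-result≤cost (pair {x = x} p q) =
  +-mono-≤ (+-mono-≤ (1≤size x) (size-result≤cost p)) (size-result≤cost q)
  where
  1≤size : ∀ x → 1 ≤ size x
  1≤size leaf = ≤-refl
  1≤size (node _ _) = s≤s z≤n
size-result≤cost (seq p q)          = m≤n⇒m≤o+n _ (size-result≤cost q)
size-result≤cost (if-true c p)      = m≤n⇒m≤o+n _ (size-result≤cost p)
size-result≤cost (if-false c p)     = m≤n⇒m≤o+n _ (size-result≤cost p)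
size-result≤cost (while-stop c)     = m≤m+n _ _
size-result≤cost (while-step c p w) = m≤n⇒m≤o+n _ (size-result≤cost w)

size-result≤ : ∀ {p β x y} → Runs p β x y → size y ≤ eval β (size x)
size-result≤ r = ≤-trans (size-result≤cost (Runs.exec r)) (Runs.cost≤ r)

skipᴿ : ∀ {x} → Runs skip var x x
skipᴿ = runs skip ≤-refl

nilᴿ : ∀ {x} → Runs nil var x leaf
nilᴿ = runs nil ≤-refl

leftᴿ : ∀ {x y} → Runs left var (node x y) x
leftᴿ = runs left-node ≤-refl

rightᴿ : ∀ {x y} → Runs right var (node x y) y
rightᴿ = runs right-node ≤-refl

pairᴿ : ∀ {p q α β x y z} → Runs p α x y → Runs q β x z →
        Runs (pair p q) (var ⊕ α ⊕ β) x (node y z)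
pairᴿ (runs e e≤) (runs f f≤) = runs (pair e f) (+-mono-≤ (+-monoʳ-≤ _ e≤) f≤)

infixr 5 _⨾ᴿ_

_⨾ᴿ_ : ∀ {p q α β x y z} → Runs p α x y → Runs q β y z →
       Runs (p ⨾ q) (var ⊕ α ⊕ β ∘ₚ α) x z
_⨾ᴿ_ {β = β} r@(runs e e≤) (runs f f≤) =
  runs (seq e f) (+-mono-≤ (+-monoʳ-≤ _ e≤) (≤-trans f≤ (eval-mono β (size-result≤ r))))

-- The bounds of both branches are added, because a single bound has to serve for either outcome of
-- the test.
if-trueᴿ : ∀ {c p q α β γ x l r y} → Runs c α x (node l r) → Runs p β x y →
           Runs (if c p q) (var ⊕ α ⊕ (β ⊕ γ)) x y
if-trueᴿ (runs c c≤) (runs p p≤) = runs (if-true c p) (+-mono-≤ (+-monoʳ-≤ _ c≤) (m≤n⇒m≤n+o _ p≤))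

if-falseᴿ : ∀ {c p q α β γ x y} → Runs c α x leaf → Runs q γ x y →
            Runs (if c p q) (var ⊕ α ⊕ (β ⊕ γ)) x y
if-falseᴿ {β = β} {x = x} (runs c c≤) (runs q q≤) =
  runs (if-false c q) (+-mono-≤ (+-monoʳ-≤ _ c≤) (m≤n⇒m≤o+n (eval β (size x)) q≤))

-- Both loops used below move the elements of a list one by one from a stack
-- rs to a stack sfx, so that rs ʳ++ sfx is invariant.
whileᴿ : ∀ {A : Set} {c b} (σ : Poly) {γ β} (state : List A → List A → Tree) ys →
  suc (length ys) ≤ size (state ys []) →
  (∀ rs sfx → rs ʳ++ sfx ≡ ys ʳ++ [] → size (state rs sfx) ≤ eval σ (size (state ys []))) →
  (∀ sfx → Runs c γ (state [] sfx) leaf) →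
  (∀ x rs sfx → ∃[ l ] ∃[ r ] Runs c γ (state (x ∷ rs) sfx) (node l r)) →
  (∀ x rs sfx → Runs b β (state (x ∷ rs) sfx) (state rs (x ∷ sfx))) →
  Runs (while c b) (var ⊛ (σ ⊕ γ ∘ₚ σ ⊕ β ∘ₚ σ)) (state ys []) (state [] (reverse ys))
whileᴿ {c = c} {b} σ {γ} {β} state ys len≤ size≤ stop test body with loop ys [] refl
  where
  -- `S` bounds every state that is reached, and `C` the cost of one round with its test and body.
  S = eval σ (size (state ys []))
  C = S + eval γ S + eval β S

  loop : ∀ rs sfx → rs ʳ++ sfx ≡ ys ʳ++ [] →
    ∃[ t ] (while c b on state rs sfx ⇓ state [] (rs ʳ++ sfx) cost t) × t ≤ suc (length rs) * C
  loop [] sfx eq with stop sfx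
  ... | runs s s≤ = _ , while-stop s ,
    (begin
      _          ≤⟨ +-mono-≤ (size≤ [] sfx eq) (≤-trans s≤ (eval-mono γ (size≤ [] sfx eq))) ⟩
      S + eval γ S ≤⟨ m≤m+n _ _ ⟩
      C          ≡⟨ *-identityˡ C ⟨
      1 * C      ∎)
    where open ≤-Reasoning
  loop (x ∷ rs) sfx eq with test x rs sfx | body x rs sfx | loop rs (x ∷ sfx) eq
  ... | _ , _ , runs s s≤ | runs u u≤ | t , w , t≤ = _ , while-step s u w ,
    +-mono-≤ (+-mono-≤ (+-mono-≤ le (≤-trans s≤ (eval-mono γ le))) (≤-trans u≤ (eval-mono β le))) t≤
    where le = size≤ (x ∷ rs) sfx eq
-- The rounds, including the final test, are at most as many as the size of the initial state; this
-- is the factor `var`.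
... | t , w , t≤ = runs w (≤-trans t≤ (*-monoˡ-≤ _ len≤))

length<size : ∀ {A : Set} (e : A → Tree) xs → length xs < size (encodeList e xs)
length<size e []       = s≤s z≤n
length<size e (x ∷ xs) = s≤s (m≤n⇒m≤o+n (size (e x)) (length<size e xs))

-- Moving an entry between the stacks does not change their total size. Two stacks have two final
-- leaves, a single list has one: hence the `suc`.
size-ʳ++ : ∀ {A : Set} (e : A → Tree) rs sfx →
  size (encodeList e rs) + size (encodeList e sfx) ≡ suc (size (encodeList e (rs ʳ++ sfx)))
size-ʳ++ e []       sfx = refl
size-ʳ++ e (x ∷ rs) sfx = trans (lemma (size (e x)) (size (encodeList e rs)) (size (encodeList e sfx))) (size-ʳ++ e rs (x ∷ sfx))
  where
  lemma : ∀ a b c → suc (a + b) + c ≡ b + suc (a + c)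
  lemma = solve-∀

reverseᴾ : Program
reverseᴾ = pair skip nil ⨾ while left (pair (left ⨾ right) (pair (left ⨾ left) right)) ⨾ right

reverseᴿ : Σ[ β ∈ Poly ] ∀ {A : Set} (e : A → Tree) xs →
  Runs reverseᴾ β (encodeList e xs) (encodeList e (reverse xs))
reverseᴿ = _ , λ e xs → pairᴿ skipᴿ nilᴿ ⨾ᴿ
  whileᴿ var (λ rs sfx → node (encodeList e rs) (encodeList e sfx)) xs
    (≤-trans (length<size e xs) (m≤n⇒m≤1+n (m≤m+n _ _)))
    (λ rs sfx eq → s≤s (≤-reflexive (trans (size-ʳ++ e rs sfx)
      (trans (cong (λ l → suc (size (encodeList e l))) eq) (sym (size-ʳ++ e xs []))))))
    (λ _ → leftᴿ)
    (λ _ _ _ → _ , _ , leftᴿ)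
    (λ _ _ _ → pairᴿ (leftᴿ ⨾ᴿ rightᴿ) (pairᴿ (leftᴿ ⨾ᴿ leftᴿ) rightᴿ))
  ⨾ᴿ rightᴿ

-- Uniform polynomial-time functions

infixl 5 _⊗_

data Ty : Set where
  bool vertex matrix integer : Ty
  list : Ty → Ty
  _⊗_  : Ty → Ty → Ty

⟦_⟧ : Ty → ℕ → Set
⟦ bool ⟧    n = Bool
⟦ vertex ⟧  n = Fin n
⟦ matrix ⟧  n = Fin n → Fin n → Bool
⟦ integer ⟧ n = ℤ
⟦ list t ⟧  n = List (⟦ t ⟧ n)
⟦ s ⊗ t ⟧   n = ⟦ s ⟧ n × ⟦ t ⟧ n

-- These encodings compute to those of the problem, so a term for the kernel runs directly on an
-- encoded instance.
enc : ∀ t n → ⟦ t ⟧ n → Tree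
enc bool     n b       = encodeBool b
enc vertex   n i       = encodeVertex i
enc matrix   n arc     = encodeList (λ i → encodeList (λ j → encodeBool (arc i j)) (allFin n)) (allFin n)
enc integer  n z       = encodeℤ z
enc (list t) n xs      = encodeList (enc t n) xs
enc (s ⊗ t)  n (x , y) = node (enc s n x) (enc t n y)

-- The program must not depend on the number n of vertices.  The input type
-- doubles as a context: in a term over Γ ⊗ s ⊗ t the components act as de
-- Bruijn variables, #0 of type t and #1 of type s.
record Term (s t : Ty) : Set where
  field
    fun   : ∀ n → ⟦ s ⟧ n → ⟦ t ⟧ n
    prog  : Program
    bound : Poly
    run   : ∀ n x → Runs prog bound (enc s n x) (enc t n (fun n x))

open Term

private
  variable
    Γ s t u : Ty

size-fun≤ : (e : Term s t) → ∀ n x → size (enc t n (fun e n x)) ≤ eval (bound e) (size (enc s n x))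
size-fun≤ e n x = size-result≤ (run e n x)

infixr 9 _∘ᵀ_

_∘ᵀ_ : Term s t → Term Γ s → Term Γ t
f ∘ᵀ e = record
  { fun = λ n x → fun f n (fun e n x)
  ; run = λ n x → run e n x ⨾ᴿ run f n (fun e n x)
  }

⟨_,_⟩ᵀ : Term Γ s → Term Γ t → Term Γ (s ⊗ t)
⟨ e , f ⟩ᵀ = record { fun = λ n x → fun e n x , fun f n x ; run = λ n x → pairᴿ (run e n x) (run f n x) }

#0 : Term (Γ ⊗ t) t
#0 = record { fun = λ _ → proj₂ ; run = λ _ _ → rightᴿ }

wk : Term Γ t → Term (Γ ⊗ s) t
wk e = e ∘ᵀ record { fun = λ _ → proj₁ ; run = λ _ _ → leftᴿ }

idᵀ : Term t t
idᵀ = record { fun = λ _ x → x ; run = λ _ _ → skipᴿ }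

#1 : Term (Γ ⊗ t ⊗ s) t
#1 = wk #0

-- Only the encodings have to agree, so a value can also be reread at another type: a vertex as a
-- unary number, or a matrix as the list of its rows.
castᵀ : (e : Term s t) (f : ∀ n → ⟦ s ⟧ n → ⟦ u ⟧ n) →
        (∀ n x → enc t n (fun e n x) ≡ enc u n (f n x)) → Term s u
castᵀ e f eq = record
  { fun = f ; run = λ n x → subst (Runs (prog e) (bound e) _) (eq n x) (run e n x) }

falseᵀ : Term Γ bool
falseᵀ = record { fun = λ _ _ → false ; run = λ _ _ → nilᴿ }

trueᵀ : Term Γ bool
trueᵀ = record { fun = λ _ _ → true ; run = λ _ _ → pairᴿ nilᴿ nilᴿ }

[]ᵀ : Term Γ (list t)
[]ᵀ = record { fun = λ _ _ → [] ; run = λ _ _ → nilᴿ }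

infixr 5 _∷ᵀ_

_∷ᵀ_ : Term Γ t → Term Γ (list t) → Term Γ (list t)
e ∷ᵀ f = record { fun = λ n x → fun e n x ∷ fun f n x ; run = λ n x → pairᴿ (run e n x) (run f n x) }

ifᵀ : Term Γ bool → Term Γ t → Term Γ t → Term Γ t
ifᵀ {t = t} c e f = record
  { fun = λ n x → if fun c n x then fun e n x else fun f n x
  ; run = λ n x → branch n (fun c n x) (run c n x) (run e n x) (run f n x)
  }
  where
  branch : ∀ n b {p q r α β γ x y z} →
    Runs p α x (encodeBool b) → Runs q β x (enc t n y) → Runs r γ x (enc t n z) →
    Runs (if p q r) (var ⊕ α ⊕ (β ⊕ γ)) x (enc t n (if b then y else z))
  branch n true  c e f = if-trueᴿ c e
  branch n false c e f = if-falseᴿ c f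

notᵀ : Term Γ bool → Term Γ bool
notᵀ e = castᵀ (ifᵀ e falseᵀ trueᵀ) (λ n x → not (fun e n x)) λ n x → cong encodeBool (if-not (fun e n x))
  where
  if-not : ∀ b → (if b then false else true) ≡ not b
  if-not true  = refl
  if-not false = refl

infixr 6 _∧ᵀ_
infixr 5 _∨ᵀ_

_∧ᵀ_ : Term Γ bool → Term Γ bool → Term Γ bool
e ∧ᵀ f = castᵀ (ifᵀ e f falseᵀ) (λ n x → fun e n x ∧ fun f n x) λ n x → cong encodeBool (if-∧ (fun e n x))
  where
  if-∧ : ∀ b {c} → (if b then c else false) ≡ b ∧ c
  if-∧ true  = refl
  if-∧ false = refl

_∨ᵀ_ : Term Γ bool → Term Γ bool → Term Γ bool
e ∨ᵀ f = castᵀ (ifᵀ e trueᵀ f) (λ n x → fun e n x ∨ fun f n x) λ n x → cong encodeBool (if-∨ (fun e n x))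
  where
  if-∨ : ∀ b {c} → (if b then true else c) ≡ b ∨ c
  if-∨ true  = refl
  if-∨ false = refl

-- A loop over the reversed list computes `foldr`; its accumulators are the folds over suffixes.
-- Their size must be bounded separately, since iterating a polynomial step, such as doubling, can
-- lead to exponential size.
foldᵀ : (l : Term Γ (list s)) (z : Term Γ t) (f : Term (Γ ⊗ s ⊗ t) t) (β : Poly) →
  (∀ n x l → size (enc t n (foldr (λ a y → fun f n ((x , a) , y)) (fun z n x) l))
             ≤ eval β (size (enc Γ n x) + size (enc (list s) n l))) →
  Term Γ t
foldᵀ {Γ} {s} {t} l z f β fold≤ = record
  { fun = λ n x → foldr (λ a y → fun f n ((x , a) , y)) (fun z n x) (fun l n x)
  ; run = λ n x →
      pairᴿ skipᴿ (pairᴿ (run l n x ⨾ᴿ proj₂ reverseᴿ (enc s n) (fun l n x)) (run z n x)) ⨾ᴿ loopᴿ n x (fun l n x) ⨾ᴿ rightᴿ ⨾ᴿ rightᴿ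
  }
  where
  state : ∀ n → ⟦ Γ ⟧ n → List (⟦ s ⟧ n) → List (⟦ s ⟧ n) → Tree
  state n x rs sfx = node (enc Γ n x) (node (enc (list s) n rs)
    (enc t n (foldr (λ a y → fun f n ((x , a) , y)) (fun z n x) sfx)))

  state≤ : ∀ n x ys rs sfx → rs ʳ++ sfx ≡ ys ʳ++ [] →
           size (state n x rs sfx) ≤ eval (var ⊕ β) (size (state n x ys []))
  state≤ n x ys rs sfx eq = begin
    suc (g + suc (size (E rs) + size (F sfx)))
      ≤⟨ s≤s (+-monoʳ-≤ g (s≤s (+-mono-≤ rs≤
           (≤-trans (fold≤ n x sfx) (eval-mono β (≤-trans (+-monoʳ-≤ g sfx≤) S≥)))))) ⟩
    suc (g + suc (size (E ys) + eval β S))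
      ≡⟨ lemma g (size (E ys)) (eval β S) ⟩
    suc (g + suc (size (E ys))) + eval β S
      ≤⟨ +-monoˡ-≤ (eval β S) (s≤s (+-monoʳ-≤ g (s≤s (m≤m+n _ _)))) ⟩
    S + eval β S ∎
    where
    open ≤-Reasoning
    g = size (enc Γ n x)
    E = enc (list s) n
    F = λ sfx → enc t n (foldr (λ a y → fun f n ((x , a) , y)) (fun z n x) sfx)
    S = size (state n x ys [])
    lemma : ∀ a b c → suc (a + suc (b + c)) ≡ suc (a + suc b) + c
    lemma = solve-∀
    total : size (E rs) + size (E sfx) ≡ suc (size (E ys))
    total = trans (size-ʳ++ (enc s n) rs sfx) (trans (cong (λ l → suc (size (E l))) eq)
      (trans (sym (size-ʳ++ (enc s n) ys [])) (+-comm _ 1)))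
    positive : ∀ l → 1 ≤ size (E l)
    positive l = ≤-trans (s≤s z≤n) (length<size (enc s n) l)
    rs≤ : size (E rs) ≤ size (E ys)
    rs≤ = +-cancelʳ-≤ 1 _ _ (≤-trans (+-monoʳ-≤ (size (E rs)) (positive sfx)) (≤-reflexive (trans total (+-comm 1 _))))
    sfx≤ : size (E sfx) ≤ size (E ys)
    sfx≤ = +-cancelˡ-≤ 1 _ _ (≤-trans (+-monoˡ-≤ (size (E sfx)) (positive rs)) (≤-reflexive total))
    S≥ : g + size (E ys) ≤ S
    S≥ = m≤n⇒m≤1+n (+-monoʳ-≤ g (m≤n⇒m≤1+n (m≤m+n _ _)))

  loopᴿ : ∀ n x l → Runs _ _ (state n x (reverse l) []) (state n x [] l)
  loopᴿ n x l = subst (λ l′ → Runs _ _ (state n x (reverse l) []) (state n x [] l′)) (reverse-involutive l)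
    (whileᴿ (var ⊕ β) (state n x) (reverse l)
      (≤-trans (length<size (enc s n) (reverse l)) (m≤n⇒m≤1+n (m≤n⇒m≤o+n (size (enc Γ n x)) (m≤n⇒m≤1+n (m≤m+n _ _)))))
      (state≤ n x (reverse l))
      (λ _ → rightᴿ ⨾ᴿ leftᴿ)
      (λ _ _ _ → _ , _ , (rightᴿ ⨾ᴿ leftᴿ))
      (λ a rs sfx → pairᴿ leftᴿ (pairᴿ (rightᴿ ⨾ᴿ leftᴿ ⨾ᴿ rightᴿ)
        (pairᴿ (pairᴿ leftᴿ (rightᴿ ⨾ᴿ leftᴿ ⨾ᴿ leftᴿ)) (rightᴿ ⨾ᴿ rightᴿ) ⨾ᴿ run f n _))))

-- The bound on the size of the accumulator is automatic when every step adds
-- to it at most an amount that does not depend on it.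
fold⁺ᵀ : (l : Term Γ (list s)) (z : Term Γ t) (f : Term (Γ ⊗ s ⊗ t) t) (κ : Poly) →
  (∀ n x a y → size (enc t n (fun f n ((x , a) , y)))
               ≤ eval κ (size (enc Γ n x) + size (enc s n a)) + size (enc t n y)) →
  Term Γ t
fold⁺ᵀ {Γ} {s} {t} l z f κ step≤ = foldᵀ l z f (var ⊛ κ ⊕ bound z) λ n x l →
  let g = size (enc Γ n x) in
  ≤-trans (fold≤ n x (g + size (enc (list s) n l)) l ≤-refl)
    (+-mono-≤ (*-monoˡ-≤ _ (m≤n+m _ g)) (≤-trans (size-fun≤ z n x) (eval-mono (bound z) (m≤m+n g _))))
  where
  fold≤ : ∀ n x S l → size (enc Γ n x) + size (enc (list s) n l) ≤ S →
    size (enc t n (foldr (λ a y → fun f n ((x , a) , y)) (fun z n x) l))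
    ≤ size (enc (list s) n l) * eval κ S + size (enc t n (fun z n x))
  fold≤ n x S []      le = m≤n+m _ _
  fold≤ n x S (a ∷ l) le = begin
    size (enc t n (fun f n ((x , a) , y)))   ≤⟨ step≤ n x a y ⟩
    eval κ (g + A) + size (enc t n y)        ≤⟨ +-mono-≤
      (eval-mono κ (≤-trans (+-monoʳ-≤ g (m≤n⇒m≤1+n (m≤m+n A L))) le))
      (fold≤ n x S l (≤-trans (+-monoʳ-≤ g (m≤n⇒m≤1+n (m≤n+m L A))) le)) ⟩
    eval κ S + (L * eval κ S + Z)            ≡⟨ +-assoc (eval κ S) _ _ ⟨
    suc L * eval κ S + Z                     ≤⟨ +-monoˡ-≤ Z (*-monoˡ-≤ (eval κ S) (s≤s (m≤n+m L A))) ⟩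
    suc (A + L) * eval κ S + Z               ∎
    where
    open ≤-Reasoning
    g = size (enc Γ n x)
    A = size (enc s n a)
    L = size (enc (list s) n l)
    Z = size (enc t n (fun z n x))
    y = foldr (λ a y → fun f n ((x , a) , y)) (fun z n x) l

-- Lists, unary numbers and matrices

nullᵀ : Term (list t) bool
nullᵀ {t} = record { fun = λ _ → null ; run = nullᴿ }
  where
  nullᴿ : ∀ n xs → Runs (if skip nil (pair nil nil)) _ (enc (list t) n xs) (encodeBool (null xs))
  nullᴿ n []       = if-falseᴿ skipᴿ (pairᴿ nilᴿ nilᴿ)
  nullᴿ n (_ ∷ _) = if-trueᴿ skipᴿ nilᴿ

tailᵀ : Term (list t) (list t)
tailᵀ {t} = record { fun = λ _ → drop 1 ; run = tailᴿ }
  where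
  tailᴿ : ∀ n xs → Runs right var (enc (list t) n xs) (enc (list t) n (drop 1 xs))
  tailᴿ n []      = runs right-leaf ≤-refl
  tailᴿ n (_ ∷ _) = rightᴿ

headOr : ∀ {A : Set} → A → List A → A
headOr d xs = fromMaybe d (head xs)

-- The default value must be encoded as leaf, since this is what left returns.
headOrᵀ : (d : ∀ n → ⟦ t ⟧ n) → (∀ n → leaf ≡ enc t n (d n)) → Term (list t) t
headOrᵀ {t} d eq = record { fun = λ n → headOr (d n) ; run = headᴿ }
  where
  headᴿ : ∀ n xs → Runs left var (enc (list t) n xs) (enc t n (headOr (d n) xs))
  headᴿ n []      = subst (Runs left var leaf) (eq n) (runs left-leaf ≤-refl)
  headᴿ n (_ ∷ _) = leftᴿ

take₁++ᵀ : Term Γ (list t) → Term Γ (list t) → Term Γ (list t)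
take₁++ᵀ {Γ} {t} e f = record
  { fun = λ n x → take 1 (fun e n x) ++ fun f n x
  ; run = λ n x → branch n (fun e n x) (run e n x) (run f n x)
  }
  where
  branch : ∀ n xs {ys p q α β x} → Runs p α x (enc (list t) n xs) → Runs q β x (enc (list t) n ys) →
    Runs (if p (pair (p ⨾ left) q) q) (var ⊕ α ⊕ ((var ⊕ (var ⊕ α ⊕ var ∘ₚ α) ⊕ β) ⊕ β)) x (enc (list t) n (take 1 xs ++ ys))
  branch n []      e f = if-falseᴿ e f
  branch n (_ ∷ _) e f = if-trueᴿ e (pairᴿ (e ⨾ᴿ leftᴿ) f)

size-node≤ : ∀ g a y → size (node a y) ≤ suc (g + size a) + size y
size-node≤ g a y = s≤s (+-monoˡ-≤ (size y) (m≤n+m (size a) g))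

infixr 5 _++ᵀ_

_++ᵀ_ : Term Γ (list t) → Term Γ (list t) → Term Γ (list t)
_++ᵀ_ {Γ} {t} e f = castᵀ (fold⁺ᵀ e f (#1 ∷ᵀ #0) (con 1 ⊕ var) λ n x a y →
    size-node≤ (size (enc Γ n x)) (enc t n a) (enc (list t) n y))
  (λ n x → fun e n x ++ fun f n x)
  (λ n x → cong (enc (list _) n) (sym (++-is-foldr (fun e n x) (fun f n x))))

mapᵀ : Term (Γ ⊗ s) t → Term Γ (list s) → Term Γ (list t)
mapᵀ f l = castᵀ (fold⁺ᵀ l []ᵀ (wk f ∷ᵀ #0) (con 1 ⊕ bound f ∘ₚ (con 1 ⊕ var)) λ n x a y →
    s≤s (+-monoˡ-≤ _ (size-fun≤ f n (x , a))))
  (λ n x → map (λ a → fun f n (x , a)) (fun l n x))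
  (λ n x → cong (enc (list _) n) (sym (map-is-foldr (fun l n x))))

filterᵀ : Term (Γ ⊗ s) bool → Term Γ (list s) → Term Γ (list s)
filterᵀ {Γ} {s} p l = castᵀ (fold⁺ᵀ l []ᵀ (ifᵀ (wk p) (#1 ∷ᵀ #0) #0) (con 1 ⊕ var) step≤)
  (λ n x → filterᵇ (λ a → fun p n (x , a)) (fun l n x))
  (λ n x → cong (enc (list _) n) (filter-is-foldr (λ a → fun p n (x , a)) (fun l n x)))
  where
  step≤ : ∀ n x a y → size (enc (list s) n (if fun p n (x , a) then a ∷ y else y))
    ≤ suc (size (enc Γ n x) + size (enc s n a)) + size (enc (list s) n y)
  step≤ n x a y with fun p n (x , a)
  ... | true  = size-node≤ (size (enc Γ n x)) (enc s n a) (enc (list s) n y)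
  ... | false = m≤n+m _ _
  filter-is-foldr : ∀ {A : Set} (p : A → Bool) xs →
    foldr (λ a y → if p a then a ∷ y else y) [] xs ≡ filterᵇ p xs
  filter-is-foldr p []       = refl
  filter-is-foldr p (x ∷ xs) rewrite filter-is-foldr p xs with p x
  ... | true  = refl
  ... | false = refl

size-bool≤ : ∀ b → size (encodeBool b) ≤ 3
size-bool≤ true  = ≤-refl
size-bool≤ false = s≤s z≤n

anyᵀ : Term (Γ ⊗ s) bool → Term Γ (list s) → Term Γ bool
anyᵀ p l = castᵀ (fold⁺ᵀ l falseᵀ (wk p ∨ᵀ #0) (con 3) λ n x a y →
    ≤-trans (size-bool≤ (fun p n (x , a) ∨ y)) (m≤m+n 3 _))
  (λ n x → any (λ a → fun p n (x , a)) (fun l n x))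
  (λ n x → cong encodeBool (any-is-foldr (λ a → fun p n (x , a)) (fun l n x)))
  where
  any-is-foldr : ∀ {A : Set} (p : A → Bool) xs →
    foldr (λ a y → p a ∨ y) false xs ≡ any p xs
  any-is-foldr p []       = refl
  any-is-foldr p (x ∷ xs) = cong (p x ∨_) (any-is-foldr p xs)

drop-length : ∀ {A B : Set} (xs : List A) (ys : List B) →
  foldr (λ _ → drop 1) ys xs ≡ drop (length xs) ys
drop-length []       ys = refl
drop-length (x ∷ xs) ys = trans (cong (drop 1) (drop-length xs ys)) (drop-suc (length xs) ys)
  where
  drop-suc : ∀ {B : Set} k (ys : List B) → drop 1 (drop k ys) ≡ drop (suc k) ys
  drop-suc zero    ys       = refl
  drop-suc (suc k) []       = refl
  drop-suc (suc k) (y ∷ ys) = drop-suc k ys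

-- Lists serve as unary numbers, represented by their lengths.
dropᵀ : Term Γ (list s) → Term Γ (list t) → Term Γ (list t)
dropᵀ e f = castᵀ (fold⁺ᵀ e f (tailᵀ ∘ᵀ #0) (con 0) λ n x a y → size-tail≤ n y)
  (λ n x → drop (length (fun e n x)) (fun f n x))
  (λ n x → cong (enc (list _) n) (drop-length (fun e n x) (fun f n x)))
  where
  size-tail≤ : ∀ n y → size (enc (list _) n (drop 1 y)) ≤ size (enc (list _) n y)
  size-tail≤ n []      = ≤-refl
  size-tail≤ n (a ∷ y) = m≤n⇒m≤1+n (m≤n+m _ _)

length≤ᵀ : Term Γ (list s) → Term Γ (list t) → Term Γ bool
length≤ᵀ e f = castᵀ (nullᵀ ∘ᵀ dropᵀ f e)
  (λ n x → length (fun e n x) ≤ᵇ length (fun f n x))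
  (λ n x → cong encodeBool (null-drop (fun e n x) (length (fun f n x))))
  where
  null-drop : ∀ {A : Set} (xs : List A) k → null (drop k xs) ≡ (length xs ≤ᵇ k)
  null-drop []           zero    = refl
  null-drop []           (suc k) = refl
  null-drop (x ∷ xs)     zero    = refl
  null-drop (x ∷ [])     (suc k) = null-drop [] k
  null-drop (x ∷ y ∷ xs) (suc k) = null-drop (y ∷ xs) k

encodeList-map : ∀ {A B : Set} (e : B → Tree) (f : A → B) xs →
  encodeList e (map f xs) ≡ encodeList (e ∘ f) xs
encodeList-map e f []       = refl
encodeList-map e f (x ∷ xs) = cong (node (e (f x))) (encodeList-map e f xs)

encodeList-cong : ∀ {A : Set} {e e′ : A → Tree} → (∀ x → e x ≡ e′ x) → ∀ xs →
  encodeList e xs ≡ encodeList e′ xs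
encodeList-cong eq []       = refl
encodeList-cong eq (x ∷ xs) = cong₂ node (eq x) (encodeList-cong eq xs)

unary : ∀ {n} → Fin n → List Bool
unary i = replicate (toℕ i) false

unaryᵀ : Term vertex (list bool)
unaryᵀ = castᵀ idᵀ (λ _ → unary) (λ _ _ → refl)

_≡ᵀ_ : Term Γ vertex → Term Γ vertex → Term Γ bool
e ≡ᵀ f = castᵀ (length≤ᵀ (unaryᵀ ∘ᵀ e) (unaryᵀ ∘ᵀ f) ∧ᵀ length≤ᵀ (unaryᵀ ∘ᵀ f) (unaryᵀ ∘ᵀ e))
  (λ n x → does (fun e n x ≟ fun f n x))
  (λ n x → cong encodeBool (compare (fun e n x) (fun f n x)))
  where
  compare : ∀ {n} (i j : Fin n) →
    (length (unary i) ≤ᵇ length (unary j)) ∧ (length (unary j) ≤ᵇ length (unary i)) ≡ does (i ≟ j)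
  compare i j rewrite length-replicate (toℕ i) {x = false} | length-replicate (toℕ j) {x = false}
    with toℕ i ≤ᵇ toℕ j in i≤j | toℕ j ≤ᵇ toℕ i in j≤i | i ≟ j
  ... | true  | true  | yes _    = refl
  ... | true  | true  | no i≢j   = contradiction (toℕ-injective (≤-antisym
    (≤ᵇ⇒≤ _ _ (subst T (sym i≤j) _)) (≤ᵇ⇒≤ _ _ (subst T (sym j≤i) _)))) i≢j
  ... | true  | false | yes refl = contradiction (trans (sym i≤j) j≤i) λ ()
  ... | true  | false | no _     = refl
  ... | false | _     | yes refl = contradiction (subst T i≤j (≤⇒≤ᵇ (≤-refl {toℕ i}))) id
  ... | false | _     | no _     = refl

rows : ∀ {n} → (Fin n → Fin n → Bool) → List (List Bool)
rows {n} arc = map (λ i → map (arc i) (allFin n)) (allFin n)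

rowsᵀ : Term matrix (list (list bool))
rowsᵀ = castᵀ idᵀ (λ _ → rows) λ n arc → sym (trans
  (encodeList-map (encodeList encodeBool) (λ i → map (arc i) (allFin n)) (allFin n))
  (encodeList-cong (λ i → encodeList-map encodeBool (arc i) (allFin n)) (allFin n)))

headOr-drop : ∀ {A : Set} {n} (d : A) (f : Fin n → A) i →
  headOr d (drop (length (unary i)) (map f (allFin n))) ≡ f i
headOr-drop {A} d f i = trans (cong (λ xs → headOr d (drop (length (unary i)) xs)) (map-tabulate id f)) (go f i)
  where
  go : ∀ {n} (f : Fin n → A) i → headOr d (drop (length (unary i)) (tabulate f)) ≡ f i
  go f zero    = refl
  go f (suc i) = go (f ∘ suc) i

arcᵀ : Term Γ matrix → Term Γ vertex → Term Γ vertex → Term Γ bool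
arcᵀ m e f = castᵀ
  (headOrᵀ (λ _ → false) (λ _ → refl) ∘ᵀ dropᵀ (unaryᵀ ∘ᵀ f)
    (headOrᵀ {list bool} (λ _ → []) (λ _ → refl) ∘ᵀ dropᵀ (unaryᵀ ∘ᵀ e) (rowsᵀ ∘ᵀ m)))
  (λ n x → fun m n x (fun e n x) (fun f n x))
  (λ n x → cong encodeBool (lookup-rows (fun m n x) (fun e n x) (fun f n x)))
  where
  lookup-rows : ∀ {n} (arc : Fin n → Fin n → Bool) i j →
    headOr false (drop (length (unary j)) (headOr [] (drop (length (unary i)) (rows arc)))) ≡ arc i j
  lookup-rows arc i j = trans (cong (λ r → headOr false (drop (length (unary j)) r)) (headOr-drop [] (λ i → map (arc i) (allFin _)) i))
    (headOr-drop false (arc i) j)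

-- A program is not given the number of vertices. It obtains the vertices as the positions of the
-- rows of the matrix, in unary.
indices : ∀ {A : Set} → List A → List (List Bool)
indices = foldr (λ _ is → [] ∷ map (false ∷_) is) []

length-indices : ∀ {A : Set} (xs : List A) → length (indices xs) ≡ length xs
length-indices []       = refl
length-indices (x ∷ xs) = cong suc (trans (length-map (false ∷_) (indices xs)) (length-indices xs))

encodeIndices : List (List Bool) → Tree
encodeIndices = encodeList (encodeList encodeBool)

size-indices : ∀ {A : Set} (xs : List A) m → length xs ≤ m →
  size (encodeIndices (indices xs)) ≤ suc (length xs * (2 + 2 * m))
size-indices []       m le = ≤-refl
size-indices (x ∷ xs) m le = begin
  2 + size (encodeIndices (map (false ∷_) (indices xs)))
    ≡⟨ cong (2 +_) (size-map (indices xs)) ⟩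
  2 + (size (encodeIndices (indices xs)) + 2 * length (indices xs))
    ≡⟨ cong (λ k → 2 + (size (encodeIndices (indices xs)) + 2 * k)) (length-indices xs) ⟩
  2 + (size (encodeIndices (indices xs)) + 2 * length xs)
    ≤⟨ s≤s (s≤s (+-mono-≤ (size-indices xs m (<⇒≤ le)) (*-monoʳ-≤ 2 (<⇒≤ le)))) ⟩
  2 + (suc (length xs * (2 + 2 * m)) + 2 * m)
    ≡⟨ lemma (length xs) m ⟩
  suc (suc (length xs) * (2 + 2 * m)) ∎
  where
  open ≤-Reasoning
  lemma : ∀ k m → 2 + (suc (k * (2 + 2 * m)) + 2 * m) ≡ suc (suc k * (2 + 2 * m))
  lemma = solve-∀
  lemma′ : ∀ a b k → suc (suc (suc a) + (b + 2 * k)) ≡ suc (a + b) + 2 * suc k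
  lemma′ = solve-∀
  size-map : ∀ is → size (encodeIndices (map (false ∷_) is)) ≡ size (encodeIndices is) + 2 * length is
  size-map []       = refl
  size-map (i ∷ is) = trans (cong (λ z → suc (suc (suc (size (encodeList encodeBool i))) + z)) (size-map is))
    (lemma′ (size (encodeList encodeBool i)) (size (encodeIndices is)) (length is))

indicesᵀ : Term (list t) (list (list bool))
indicesᵀ {t} = foldᵀ idᵀ []ᵀ ([]ᵀ ∷ᵀ mapᵀ (falseᵀ ∷ᵀ #0) #0) (con 1 ⊕ var ⊛ (con 2 ⊕ con 2 ⊛ var))
  λ n x l → let le = ≤-trans (<⇒≤ (length<size (enc t n) l)) (m≤n+m _ (size (enc (list t) n x))) in
    ≤-trans (size-indices l _ le) (s≤s (*-monoˡ-≤ _ le))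

verticesᵀ : Term matrix (list vertex)
verticesᵀ = castᵀ (indicesᵀ ∘ᵀ rowsᵀ) (λ n _ → allFin n) λ n arc →
  trans (cong (λ is → encodeIndices is) (trans (cong indices (map-tabulate id (λ i → map (arc i) (allFin n)))) (indices-tabulate (λ i → map (arc i) (allFin n)))))
    (encodeList-map (encodeList encodeBool) unary (allFin n))
  where
  indices-tabulate : ∀ {A : Set} {n} (f : Fin n → A) → indices (tabulate f) ≡ map unary (allFin n)
  indices-tabulate {n = zero}  f = refl
  indices-tabulate {n = suc n} f = cong ([] ∷_) (trans (cong (map (false ∷_)) (trans (indices-tabulate (f ∘ suc)) (map-tabulate id unary)))
    (trans (map-tabulate unary (false ∷_)) (sym (map-tabulate suc unary))))

-- On a list sorted by a total preorder this is the usual insertion; two filters replace the search,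
-- so that it is built from operations that exist as terms.
insert : {A : Set} → (A → A → Bool) → A → List A → List A
insert _≤?_ x ys = filterᵇ (λ y → not (x ≤? y)) ys ++ x ∷ filterᵇ (x ≤?_) ys

sort : {A : Set} → (A → A → Bool) → List A → List A
sort _≤?_ = foldr (insert _≤?_) []

node-swap : ∀ a b c → 1 + (a + (1 + (b + c))) ≡ 1 + (b + (1 + (a + c)))
node-swap = solve-∀

-- The two filters are complementary, so no entry is lost or copied. Sorting therefore meets the
-- additive bound of `fold⁺ᵀ`.
size-insert : ∀ {A : Set} (e : A → Tree) p x ys →
  size (encodeList e (filterᵇ (not ∘ p) ys ++ x ∷ filterᵇ p ys)) ≡ suc (size (e x) + size (encodeList e ys))
size-insert e p x []       = refl
size-insert e p x (y ∷ ys) with p y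
... | false = trans (cong (λ z → suc (size (e y) + z)) (size-insert e p x ys))
                    (node-swap (size (e y)) (size (e x)) (size (encodeList e ys)))
... | true  = trans (shift (filterᵇ (not ∘ p) ys)) (trans (cong (λ z → suc (size (e y) + z)) (size-insert e p x ys))
                    (node-swap (size (e y)) (size (e x)) (size (encodeList e ys))))
  where
  shift : ∀ zs {ws} → size (encodeList e (zs ++ x ∷ y ∷ ws)) ≡ suc (size (e y) + size (encodeList e (zs ++ x ∷ ws)))
  shift []       {ws} = node-swap (size (e x)) (size (e y)) (size (encodeList e ws))
  shift (z ∷ zs) {ws} = trans (cong (λ w → suc (size (e z) + w)) (shift zs))
    (node-swap (size (e z)) (size (e y)) (size (encodeList e (zs ++ x ∷ ws))))

size-filter≤ : ∀ {A : Set} (e : A → Tree) p xs → size (encodeList e (filterᵇ p xs)) ≤ size (encodeList e xs)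
size-filter≤ e p []       = ≤-refl
size-filter≤ e p (x ∷ xs) with p x
... | true  = s≤s (+-monoʳ-≤ (size (e x)) (size-filter≤ e p xs))
... | false = m≤n⇒m≤1+n (m≤n⇒m≤o+n (size (e x)) (size-filter≤ e p xs))

size-take₁++≤ : ∀ {A : Set} (e : A → Tree) xs ys →
  size (encodeList e (take 1 xs ++ ys)) ≤ size (encodeList e xs) + size (encodeList e ys)
size-take₁++≤ e []       ys = n≤1+n _
size-take₁++≤ e (x ∷ xs) ys = s≤s (+-monoˡ-≤ _ (m≤m+n (size (e x)) _))

sortᵀ : Term (Γ ⊗ s ⊗ s) bool → Term Γ (list s) → Term Γ (list s)
sortᵀ {Γ} {s} le l = fold⁺ᵀ l []ᵀ
  (filterᵀ (notᵀ le′) #0 ++ᵀ #1 ∷ᵀ filterᵀ le′ #0) (con 1 ⊕ var)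
  λ n x a ys → ≤-trans (≤-reflexive (size-insert (enc s n) (λ y → fun le n ((x , a) , y)) a ys))
    (size-node≤ (size (enc Γ n x)) (enc s n a) (enc (list s) n ys))
  where
  le′ : Term (Γ ⊗ s ⊗ list s ⊗ s) bool
  le′ = le ∘ᵀ ⟨ wk (wk idᵀ) , #0 ⟩ᵀ

-- Each step adds at most one entry of `ps`, a list that does not depend on the accumulator;
-- `bound ps` is thus an additive bound.
greedyᵀ : Term (Γ ⊗ s ⊗ list t ⊗ t) bool → Term Γ (list t) → Term Γ (list s) → Term Γ (list t)
greedyᵀ {Γ} {s} {t} p ps l = fold⁺ᵀ l []ᵀ (take₁++ᵀ (filterᵀ p (wk (wk ps))) #0) (bound ps) λ n x a ys →
  ≤-trans (size-take₁++≤ (enc t n) (filterᵇ (λ v → fun p n (((x , a) , ys) , v)) (fun ps n x)) ys)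
    (+-monoˡ-≤ _ (≤-trans (size-filter≤ (enc t n) (λ v → fun p n (((x , a) , ys) , v)) (fun ps n x))
      (≤-trans (size-fun≤ ps n x) (eval-mono (bound ps) (m≤m+n _ (size (enc s n a)))))))

memberᵀ : Term Γ vertex → Term Γ (list vertex) → Term Γ bool
memberᵀ v l = anyᵀ (wk v ≡ᵀ #0) l

-- The kernelization algorithm

-- The parameters are the data alone, without the proofs about them, since these functions have to
-- be computed by terms.
module Selection {n : ℕ} (arc : Fin n → Fin n → Bool) (arcs : List (Fin n × Fin n)) where
  member : Fin n → List (Fin n) → Bool
  member v = any (λ u → does (v ≟ u))

  touched : Fin n → Bool
  touched v = any (λ e → does (v ≟ proj₁ e) ∨ does (v ≟ proj₂ e)) arcs

  free : List (Fin n)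
  free = filterᵇ (λ v → not (touched v)) (allFin n)

  before : Fin n → List (Fin n)
  before x = filterᵇ (λ v → arc v x) free

  earlier : Fin n → Fin n → Bool
  earlier x y = length (before x) ≤ᵇ length (before y)

  points : List (Fin n)
  points = sort earlier free

  -- Latest first, because foldr starts from the end of the list.
  jobs : List (Fin n × Fin n)
  jobs = sort (λ e f → earlier (proj₁ f) (proj₁ e)) arcs

  candidates : Fin n × Fin n → List (Fin n) → List (Fin n)
  candidates e l = filterᵇ (λ v → arc (proj₂ e) v ∧ arc v (proj₁ e) ∧ not (member v l)) points

  selectFor : List (Fin n × Fin n) → List (Fin n)
  selectFor = foldr (λ e l → take 1 (candidates e l) ++ l) []

  selected : List (Fin n)
  selected = selectFor jobs

  kept : List (Fin n)
  kept = filterᵇ (λ v → touched v ∨ member v selected) (allFin n)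

-- The selection as a term

Input : Ty
Input = matrix ⊗ list (vertex ⊗ vertex)

fstᵀ : Term Γ (s ⊗ t) → Term Γ s
fstᵀ e = wk idᵀ ∘ᵀ e

sndᵀ : Term Γ (s ⊗ t) → Term Γ t
sndᵀ e = #0 ∘ᵀ e

touchedᵀ : Term (Input ⊗ vertex) bool
touchedᵀ = anyᵀ ((#1 ≡ᵀ fstᵀ #0) ∨ᵀ (#1 ≡ᵀ sndᵀ #0)) #1

freeᵀ : Term Input (list vertex)
freeᵀ = filterᵀ (notᵀ touchedᵀ) (verticesᵀ ∘ᵀ fstᵀ idᵀ)

beforeᵀ : Term (Input ⊗ vertex) (list vertex)
beforeᵀ = filterᵀ (arcᵀ (fstᵀ (wk (wk idᵀ))) #0 #1) (wk freeᵀ)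

earlierᵀ : Term (Input ⊗ vertex ⊗ vertex) bool
earlierᵀ = length≤ᵀ (wk beforeᵀ) (beforeᵀ ∘ᵀ ⟨ wk (wk idᵀ) , #0 ⟩ᵀ)

pointsᵀ : Term Input (list vertex)
pointsᵀ = sortᵀ earlierᵀ freeᵀ

jobsᵀ : Term Input (list (vertex ⊗ vertex))
jobsᵀ = sortᵀ (earlierᵀ ∘ᵀ ⟨ ⟨ wk (wk idᵀ) , fstᵀ #0 ⟩ᵀ , fstᵀ #1 ⟩ᵀ) (sndᵀ idᵀ)

selectedᵀ : Term Input (list vertex)
selectedᵀ = greedyᵀ (arc′ (sndᵀ (wk #1)) #0 ∧ᵀ arc′ #0 (fstᵀ (wk #1)) ∧ᵀ notᵀ (memberᵀ #0 #1)) pointsᵀ jobsᵀ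
  where arc′ = arcᵀ (fstᵀ (wk (wk (wk idᵀ))))

keptᵀ : Term Input (list vertex)
keptᵀ = filterᵀ (touchedᵀ ∨ᵀ memberᵀ #0 (wk selectedᵀ)) (verticesᵀ ∘ᵀ fstᵀ idᵀ)

-- The target and the output

bits : ℕᵇ → List Bool
bits 0ᵇ       = []
bits 1+[2 b ] = false ∷ bits b
bits 2[1+ b ] = true ∷ bits b

digits : ℤ → List Bool
digits (pos m)    = bits (fromℕ m)
digits -[1+ m ] = bits (fromℕ m)

encode-bits : ∀ b → encodeBinary b ≡ encodeList encodeBool (bits b)
encode-bits 0ᵇ       = refl
encode-bits 1+[2 b ] = cong (node _) (encode-bits b)
encode-bits 2[1+ b ] = cong (node _) (encode-bits b)

digitsᵀ : Term integer (list bool)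
digitsᵀ = record { fun = λ _ → digits ; run = digitsᴿ }
  where
  digitsᴿ : ∀ n z → Runs right var (encodeℤ z) (encodeList encodeBool (digits z))
  digitsᴿ n (pos m)    rewrite sym (encode-bits (fromℕ m)) = rightᴿ
  digitsᴿ n -[1+ m ] rewrite sym (encode-bits (fromℕ m)) = rightᴿ

-1ᵀ : Term Γ integer
-1ᵀ = record { fun = λ _ _ → -[1+ 0 ] ; run = λ _ _ → pairᴿ (pairᴿ nilᴿ nilᴿ) nilᴿ }

-- A target with more binary digits than there are vertices cannot be reached,
-- and is replaced by the equally unreachable −1.
clamp : ∀ {A : Set} → List A → ℤ → ℤ
clamp xs z = if length (digits z) ≤ᵇ length xs then z else -[1+ 0 ]

-- The new matrix is output as a list of rows, because `matrix` always has the order of the input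
-- tournament.
kernelᵀ : Term (matrix ⊗ integer ⊗ list (vertex ⊗ vertex)) (list (list bool) ⊗ integer)
kernelᵀ = ⟨ mapᵀ (mapᵀ (arcᵀ (fstᵀ (fstᵀ (wk (wk idᵀ)))) #1 #0) (wk kept′)) kept′
          , ifᵀ (length≤ᵀ (digitsᵀ ∘ᵀ sndᵀ (fstᵀ idᵀ)) kept′) (sndᵀ (fstᵀ idᵀ)) -1ᵀ ⟩ᵀ
  where
  kept′ = keptᵀ ∘ᵀ ⟨ fstᵀ (fstᵀ idᵀ) , sndᵀ idᵀ ⟩ᵀ

-- Filtering, sorting and counting

T-not⁺ : ∀ {b} → ¬ T b → T (not b)
T-not⁺ {true}  ¬b = ¬b _
T-not⁺ {false} ¬b = _

T-not⁻ : ∀ {b} → T (not b) → ¬ T b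
T-not⁻ {true} ()

T-does⁺ : ∀ {P : Set} (P? : Dec P) → P → T (does P?)
T-does⁺ (yes _) p = _
T-does⁺ (no ¬p) p = ¬p p

T-does⁻ : ∀ {P : Set} (P? : Dec P) → T (does P?) → P
T-does⁻ (yes p) _ = p

∈-filterᵇ⁺ : ∀ {A : Set} (p : A → Bool) {x xs} → x ∈ xs → T (p x) → x ∈ filterᵇ p xs
∈-filterᵇ⁺ p = ∈-filter⁺ (T? ∘ p)

∈-filterᵇ⁻ : ∀ {A : Set} (p : A → Bool) {x xs} → x ∈ filterᵇ p xs → x ∈ xs × T (p x)
∈-filterᵇ⁻ p = ∈-filter⁻ (T? ∘ p)

length-filterᵇ-mono : ∀ {A : Set} (p q : A → Bool) xs → (∀ {x} → x ∈ xs → T (p x) → T (q x)) →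
  length (filterᵇ p xs) ≤ length (filterᵇ q xs)
length-filterᵇ-mono p q []       p⇒q = z≤n
length-filterᵇ-mono p q (x ∷ xs) p⇒q with length-filterᵇ-mono p q xs (p⇒q ∘ there) | p x | q x | p⇒q (here refl)
... | le | true  | true  | _   = s≤s le
... | le | true  | false | imp = ⊥-elim (imp _)
... | le | false | true  | _   = m≤n⇒m≤1+n le
... | le | false | false | _   = le

length-filterᵇ-strict : ∀ {A : Set} (p q : A → Bool) {xs} → (∀ {x} → x ∈ xs → T (p x) → T (q x)) →
  ∀ {y} → y ∈ xs → ¬ T (p y) → T (q y) → length (filterᵇ p xs) < length (filterᵇ q xs)
length-filterᵇ-strict p q {x ∷ xs} p⇒q (here refl) ¬py qy with p x | q x
... | false | true  = s≤s (length-filterᵇ-mono p q xs (p⇒q ∘ there))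
... | true  | _     = ⊥-elim (¬py _)
length-filterᵇ-strict p q {x ∷ xs} p⇒q (there y∈) ¬py qy
  with length-filterᵇ-strict p q (p⇒q ∘ there) y∈ ¬py qy | p x | q x | p⇒q (here refl)
... | lt | true  | true  | _   = s≤s lt
... | lt | true  | false | imp = ⊥-elim (imp _)
... | lt | false | true  | _   = m≤n⇒m≤1+n lt
... | lt | false | false | _   = lt

module _ {A : Set} (_≤?_ : A → A → Bool) where

  private
    _≼_ : A → A → Set
    x ≼ y = T (x ≤? y)

  ∈-insert⁺ : ∀ {x y ys} → y ∈ x ∷ ys → y ∈ insert _≤?_ x ys
  ∈-insert⁺ {x} {ys = ys} (here refl) = ∈-++⁺ʳ (filterᵇ (λ y → not (x ≤? y)) ys) (here refl)
  ∈-insert⁺ {x} {y} {ys} (there y∈) with T? (x ≤? y)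
  ... | yes x≤y = ∈-++⁺ʳ (filterᵇ (λ y → not (x ≤? y)) ys) (there (∈-filterᵇ⁺ (x ≤?_) y∈ x≤y))
  ... | no  x≰y = ∈-++⁺ˡ (∈-filterᵇ⁺ (λ y → not (x ≤? y)) y∈ (T-not⁺ x≰y))

  ∈-insert⁻ : ∀ {x y} ys → y ∈ insert _≤?_ x ys → y ∈ x ∷ ys
  ∈-insert⁻ {x} ys y∈ with ∈-++⁻ (filterᵇ (λ y → not (x ≤? y)) ys) y∈
  ... | inj₁ y∈′         = there (proj₁ (∈-filterᵇ⁻ (λ y → not (x ≤? y)) y∈′))
  ... | inj₂ (here refl) = here refl
  ... | inj₂ (there y∈′) = there (proj₁ (∈-filterᵇ⁻ (x ≤?_) y∈′))

  ∈-sort⁺ : ∀ {y xs} → y ∈ xs → y ∈ sort _≤?_ xs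
  ∈-sort⁺ {xs = x ∷ xs} (here refl) = ∈-insert⁺ {ys = sort _≤?_ xs} (here refl)
  ∈-sort⁺ {xs = x ∷ xs} (there y∈) = ∈-insert⁺ {x} {ys = sort _≤?_ xs} (there (∈-sort⁺ y∈))

  ∈-sort⁻ : ∀ {y} xs → y ∈ sort _≤?_ xs → y ∈ xs
  ∈-sort⁻ (x ∷ xs) y∈ with ∈-insert⁻ (sort _≤?_ xs) y∈
  ... | here refl = here refl
  ... | there y∈′ = there (∈-sort⁻ xs y∈′)

  length-sort : ∀ xs → length (sort _≤?_ xs) ≡ length xs
  length-sort []       = refl
  length-sort (x ∷ xs) = trans (length-insert (sort _≤?_ xs)) (cong suc (length-sort xs))
    where
    length-insert : ∀ ys → length (insert _≤?_ x ys) ≡ suc (length ys)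
    length-insert []       = refl
    length-insert (y ∷ ys) with x ≤? y
    ... | false = cong suc (length-insert ys)
    ... | true  = trans (length-++ (filterᵇ (λ y → not (x ≤? y)) ys))
      (trans (+-suc _ _) (cong suc (trans (sym (length-++ (filterᵇ (λ y → not (x ≤? y)) ys))) (length-insert ys))))

  module _ (total : ∀ x y → x ≼ y ⊎ y ≼ x) (transitive : ∀ {x y z} → x ≼ y → y ≼ z → x ≼ z) where

    sort-sorted : ∀ xs → AllPairs _≼_ (sort _≤?_ xs)
    sort-sorted []       = []
    sort-sorted (x ∷ xs) = AllPairsₚ.++⁺
      (AllPairsₚ.filter⁺ (λ y → T? (not (x ≤? y))) ih)
      (All.tabulate (λ y∈ → proj₂ (∈-filterᵇ⁻ (x ≤?_) {xs = ys} y∈)) ∷ AllPairsₚ.filter⁺ (λ y → T? (x ≤? y)) ih)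
      (All.tabulate λ {y} y∈ → let y≤x = y≼x y (T-not⁻ (proj₂ (∈-filterᵇ⁻ (λ y → not (x ≤? y)) {xs = ys} y∈))) in
        y≤x ∷ All.tabulate λ z∈ → transitive y≤x (proj₂ (∈-filterᵇ⁻ (x ≤?_) {xs = ys} z∈)))
      where
      ys = sort _≤?_ xs
      ih = sort-sorted xs
      y≼x : ∀ y → ¬ x ≼ y → y ≼ x
      y≼x y x⋠y with total x y
      ... | inj₁ x≼y = contradiction x≼y x⋠y
      ... | inj₂ y≼x = y≼x

lookup-injective : ∀ {A : Set} {xs : List A} → Unique xs → ∀ {i j} → lookup xs i ≡ lookup xs j → i ≡ j
lookup-injective {xs = x ∷ xs} (x∉ ∷ u) {zero}  {zero}  eq = refl
lookup-injective {xs = x ∷ xs} (x∉ ∷ u) {zero}  {suc j} eq = contradiction eq (All.lookup x∉ (∈-lookup j))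
lookup-injective {xs = x ∷ xs} (x∉ ∷ u) {suc i} {zero}  eq = contradiction (sym eq) (All.lookup x∉ (∈-lookup i))
lookup-injective {xs = x ∷ xs} (x∉ ∷ u) {suc i} {suc j} eq = cong suc (lookup-injective u eq)

-- Pigeonhole principle: sending each position in `xs` to a position of the same entry in `ys` is
-- injective.
length-Unique-⊆ : ∀ {A : Set} {xs ys : List A} → Unique xs → xs ⊆ ys → length xs ≤ length ys
length-Unique-⊆ {xs = xs} {ys} u xs⊆ys = injective⇒≤ {f = λ i → index (xs⊆ys (∈-lookup i))}
  λ {i} {j} eq → lookup-injective u
    (trans (lookup-index (xs⊆ys (∈-lookup i))) (trans (cong (lookup ys) eq) (sym (lookup-index (xs⊆ys (∈-lookup j))))))

-- Transposition of two vertices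

swap : ∀ {n} → Fin n → Fin n → Fin n → Fin n
swap p q v = if does (v ≟ p) then q else if does (v ≟ q) then p else v

swap-p : ∀ {n} (p q : Fin n) → swap p q p ≡ q
swap-p p q with p ≟ p
... | yes _  = refl
... | no p≢p = contradiction refl p≢p

swap-q : ∀ {n} (p q : Fin n) → swap p q q ≡ p
swap-q p q with q ≟ p
... | yes q≡p = q≡p
... | no _ with q ≟ q
...   | yes _  = refl
...   | no q≢q = contradiction refl q≢q

swap-other : ∀ {n} {p q v : Fin n} → v ≢ p → v ≢ q → swap p q v ≡ v
swap-other {p = p} {q} {v} v≢p v≢q with v ≟ p
... | yes v≡p = contradiction v≡p v≢p
... | no _ with v ≟ q
...   | yes v≡q = contradiction v≡q v≢q
...   | no _    = refl

swap-involutive : ∀ {n} (p q v : Fin n) → swap p q (swap p q v) ≡ v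
swap-involutive p q v = by-cases (v ≟ p) (v ≟ q)
  where
  by-cases : Dec (v ≡ p) → Dec (v ≡ q) → swap p q (swap p q v) ≡ v
  by-cases (yes refl) _          = trans (cong (swap p q) (swap-p p q)) (swap-q p q)
  by-cases (no _)     (yes refl) = trans (cong (swap p q) (swap-q p q)) (swap-p p q)
  by-cases (no v≢p)   (no v≢q)   = trans (cong (swap p q) (swap-other v≢p v≢q)) (swap-other v≢p v≢q)

-- Free vertices and triangles

module Packings {n : ℕ} (𝒯 : Tournament n) (F : FeedbackArcSet 𝒯) where
  open Tournament 𝒯
  open FeedbackArcSet F using (arcs; meets)
  open Selection arc arcs
  open DecMembership (_≟_ {n}) using (_∈?_)

  asym : ∀ {u v} → u ⟶ v → ¬ v ⟶ u
  asym {u} {v} u⟶v v⟶u with compare u v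
  ... | tri< _ _ ¬v⟶u = ¬v⟶u v⟶u
  ... | tri≈ ¬u⟶v _ _ = ¬u⟶v u⟶v
  ... | tri> ¬u⟶v _ _ = ¬u⟶v u⟶v

  connected : ∀ {u v} → u ≢ v → ¬ u ⟶ v → v ⟶ u
  connected {u} {v} u≢v ¬u⟶v with compare u v
  ... | tri< u⟶v _ _ = contradiction u⟶v ¬u⟶v
  ... | tri≈ _ u≡v _ = contradiction u≡v u≢v
  ... | tri> _ _ v⟶u = v⟶u

  ⟶⇒≢ : ∀ {u v} → u ⟶ v → u ≢ v
  ⟶⇒≢ u⟶v refl = asym u⟶v u⟶v

  Free : Fin n → Set
  Free v = ¬ T (touched v)

  free≢touched : ∀ {u v} → Free u → T (touched v) → u ≢ v
  free≢touched fu tv refl = fu tv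

  ∈-free : ∀ {v} → Free v → v ∈ free
  ∈-free {v} fv = ∈-filterᵇ⁺ (λ v → not (touched v)) (∈-allFin v) (T-not⁺ fv)

  free⇒Free : ∀ {v} → v ∈ free → Free v
  free⇒Free v∈ = T-not⁻ (proj₂ (∈-filterᵇ⁻ (λ v → not (touched v)) {xs = allFin n} v∈))

  touched-tail : ∀ {u v} → (u , v) ∈ arcs → T (touched u)
  touched-tail {u} e∈ = any⁺ _ (lose e∈ (Equivalence.from T-∨ (inj₁ (T-does⁺ (u ≟ u) refl))))

  touched-head : ∀ {u v} → (u , v) ∈ arcs → T (touched v)
  touched-head {u} {v} e∈ = any⁺ _ (lose e∈ (Equivalence.from (T-∨ {does (v ≟ u)}) (inj₂ (T-does⁺ (v ≟ v) refl))))

  triangle-meets : ∀ {u v w} → u ⟶ v → v ⟶ w → w ⟶ u →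
    (u , v) ∈ arcs ⊎ (v , w) ∈ arcs ⊎ (w , u) ∈ arcs
  triangle-meets {u} {v} {w} uv vw wu with meets record
    { start    = u
    ; rest     = v ∷ w ∷ []
    ; distinct = (⟶⇒≢ uv ∷ (⟶⇒≢ wu ∘ sym) ∷ []) ∷ (⟶⇒≢ vw ∷ []) ∷ [] ∷ []
    ; areArcs  = uv ∷ vw ∷ wu ∷ []
    }
  ... | here e∈                 = inj₁ e∈
  ... | there (here e∈)         = inj₂ (inj₁ e∈)
  ... | there (there (here e∈)) = inj₂ (inj₂ e∈)

  -- Each of the three arcs has `u` or `v` as an endpoint, so with both free none of them could be
  -- in the feedback arc set.
  at-most-one-free : ∀ {u v w} → u ⟶ v → v ⟶ w → w ⟶ u → Free u → ¬ Free v
  at-most-one-free uv vw wu fu fv with triangle-meets uv vw wu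
  ... | inj₁ e∈        = fu (touched-tail e∈)
  ... | inj₂ (inj₁ e∈) = fv (touched-tail e∈)
  ... | inj₂ (inj₂ e∈) = fu (touched-head e∈)

  -- Ranks

  rank : Fin n → ℕ
  rank x = length (before x)

  -- A free `v` with `v ⟶ q` but not `v ⟶ y` would form a triangle with `q` and `y` that has two
  -- free vertices. The inequality is strict because `q` itself is counted for `y` but not for `q`.
  free⟶⇒rank< : ∀ {q y} → Free q → q ⟶ y → rank q < rank y
  free⟶⇒rank< {q} {y} fq q⟶y = length-filterᵇ-strict (λ v → arc v q) (λ v → arc v y) imp
    (∈-free fq) (λ q⟶q → asym q⟶q q⟶q) q⟶y
    where
    imp : ∀ {v} → v ∈ free → v ⟶ q → v ⟶ y
    imp {v} v∈ v⟶q with T? (arc v y)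
    ... | yes v⟶y = v⟶y
    ... | no ¬v⟶y = contradiction fq (at-most-one-free v⟶q q⟶y
      (connected (λ { refl → asym q⟶y v⟶q }) ¬v⟶y) (free⇒Free v∈))

  -- Again a counterexample `v` would give a triangle with the two free vertices `v` and `q`. By the
  -- two lemmas, for a free `q` and `x ≢ q`, the arc goes from `q` to `x` exactly if
  -- `rank q < rank x`. So the free `v` with `c ⟶ v ⟶ b`, for touched `b` and `c`, are those with
  -- `rank c ≤ rank v < rank b`.
  ⟶free⇒rank≤ : ∀ {x q} → Free q → x ⟶ q → rank x ≤ rank q
  ⟶free⇒rank≤ {x} {q} fq x⟶q = length-filterᵇ-mono (λ v → arc v x) (λ v → arc v q) free imp
    where
    imp : ∀ {v} → v ∈ free → v ⟶ x → v ⟶ q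
    imp {v} v∈ v⟶x with T? (arc v q)
    ... | yes v⟶q = v⟶q
    ... | no ¬v⟶q = contradiction (free⇒Free v∈)
      (at-most-one-free (connected (λ { refl → asym x⟶q v⟶x }) ¬v⟶q) v⟶x x⟶q fq)

  earlier⇒≤ : ∀ x y → T (earlier x y) → rank x ≤ rank y
  earlier⇒≤ x y = ≤ᵇ⇒≤ (rank x) (rank y)

  ≤⇒earlier : ∀ x y → rank x ≤ rank y → T (earlier x y)
  ≤⇒earlier x y = ≤⇒≤ᵇ

  points-sorted : AllPairs (λ p q → rank p ≤ rank q) points
  points-sorted = AllPairs.map (earlier⇒≤ _ _) (sort-sorted earlier
    (λ x y → [ inj₁ ∘ ≤⇒earlier x y , inj₂ ∘ ≤⇒earlier y x ]′ (≤-total (rank x) (rank y)))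
    (λ {x} {y} {z} x≤y y≤z → ≤⇒earlier x z (≤-trans (earlier⇒≤ x y x≤y) (earlier⇒≤ y z y≤z)))
    free)

  jobs-sorted : AllPairs (λ e f → rank (proj₁ f) ≤ rank (proj₁ e)) jobs
  jobs-sorted = AllPairs.map (earlier⇒≤ _ _) (sort-sorted _
    (λ e f → [ inj₁ ∘ ≤⇒earlier _ _ , inj₂ ∘ ≤⇒earlier _ _ ]′ (≤-total (rank (proj₁ f)) (rank (proj₁ e))))
    (λ {e} {f} {g} f≤e g≤f → ≤⇒earlier (proj₁ g) (proj₁ e)
      (≤-trans (earlier⇒≤ (proj₁ g) (proj₁ f) g≤f) (earlier⇒≤ (proj₁ f) (proj₁ e) f≤e)))
    arcs)

  member⇒∈ : ∀ {v l} → T (member v l) → v ∈ l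
  member⇒∈ {v} {l} m = Any.map (λ {u} → T-does⁻ (v ≟ u)) (any⁻ _ l m)

  ∈⇒member : ∀ {v l} → v ∈ l → T (member v l)
  ∈⇒member {v} v∈ = any⁺ _ (Any.map (λ {u} → T-does⁺ (v ≟ u)) v∈)

  -- If a vertex of the triangle is free, it is the vertex a.
  record Normal (t : Triangle 𝒯) : Set where
    open Triangle t
    field
      b-touched : T (touched b)
      c-touched : T (touched c)
      bc∈arcs   : Free a → (b , c) ∈ arcs

  -- A rotation brings the free vertex, if there is one, to the front. The feedback arc of the
  -- triangle avoids it, so it must be the arc from `b` to `c`.
  normalize : (t : Triangle 𝒯) → Σ[ t′ ∈ Triangle 𝒯 ] Normal t′ × Triangle.vertices t′ ⊆ Triangle.vertices t
  normalize t = go (T? (touched a)) (T? (touched b)) (T? (touched c))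
    where
    open Triangle t
    first-free : ∀ {a b c} → a ⟶ b → b ⟶ c → c ⟶ a → Free a → T (touched b) × T (touched c) × (Free a → (b , c) ∈ arcs)
    first-free ab bc ca fa with triangle-meets ab bc ca
    ... | inj₁ e∈        = contradiction (touched-tail e∈) fa
    ... | inj₂ (inj₁ e∈) = touched-tail e∈ , touched-head e∈ , λ _ → e∈
    ... | inj₂ (inj₂ e∈) = contradiction (touched-head e∈) fa

    go : Dec (T (touched a)) → Dec (T (touched b)) → Dec (T (touched c)) →
      Σ[ t′ ∈ Triangle 𝒯 ] Normal t′ × Triangle.vertices t′ ⊆ vertices
    go (no fa) _ _ = let x , y , z = first-free a⟶b b⟶c c⟶a fa in
      t , record { b-touched = x ; c-touched = y ; bc∈arcs = z } , λ v∈ → v∈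
    go (yes _) (no fb) _ = let x , y , z = first-free b⟶c c⟶a a⟶b fb in
      record { a = b ; b = c ; c = a ; a⟶b = b⟶c ; b⟶c = c⟶a ; c⟶a = a⟶b } ,
      record { b-touched = x ; c-touched = y ; bc∈arcs = z } ,
      λ { (here e) → there (here e) ; (there (here e)) → there (there (here e)) ; (there (there (here e))) → here e }
    go (yes _) (yes _) (no fc) = let x , y , z = first-free c⟶a a⟶b b⟶c fc in
      record { a = c ; b = a ; c = b ; a⟶b = c⟶a ; b⟶c = a⟶b ; c⟶a = b⟶c } ,
      record { b-touched = x ; c-touched = y ; bc∈arcs = z } ,
      λ { (here e) → there (there (here e)) ; (there (here e)) → here e ; (there (there (here e))) → there (here e) }
    go (yes ta) (yes tb) (yes tc) =
      t , record { b-touched = tb ; c-touched = tc ; bc∈arcs = λ fa → contradiction ta fa } , λ v∈ → v∈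

  -- The exchange argument

  record NormalPacking (k : ℕ) : Set where
    field
      triangle : Fin k → Triangle 𝒯
      disjoint : ∀ {i j} → i ≢ j → VertexDisjoint 𝒯 (triangle i) (triangle j)
      normal   : ∀ i → Normal (triangle i)

    apex : Fin k → Fin n
    apex i = Triangle.a (triangle i)

    base : Fin k → Fin n × Fin n
    base i = Triangle.b (triangle i) , Triangle.c (triangle i)

  -- The invariant of the greedy algorithm, with `L` the jobs treated so far and `K` the vertices
  -- selected for them.
  Served : ∀ {k} → List (Fin n × Fin n) → List (Fin n) → NormalPacking k → Set
  Served L K P = ∀ i → Free (apex i) → base i ∈ L → apex i ∈ K
    where open NormalPacking P

  Candidate : Fin n × Fin n → List (Fin n) → Fin n → Set
  Candidate (b , c) K v = Free v × c ⟶ v × v ⟶ b × v ∉ K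

  ∈-candidates⁻ : ∀ {e K v} → v ∈ candidates e K → Candidate e K v
  ∈-candidates⁻ v∈ with ∈-filterᵇ⁻ _ {xs = points} v∈
  ... | v∈points , test with Equivalence.to T-∧ test
  ...   | cv , test′ with Equivalence.to T-∧ test′
  ...     | vb , v∉K = free⇒Free (∈-sort⁻ earlier free v∈points) , cv , vb , T-not⁻ v∉K ∘ ∈⇒member

  ∈-candidates⁺ : ∀ {e K v} → Candidate e K v → v ∈ candidates e K
  ∈-candidates⁺ {e} {K} {v} (fv , cv , vb , v∉K) = ∈-filterᵇ⁺ _ (∈-sort⁺ earlier (∈-free fv))
    (Equivalence.from T-∧ (cv , Equivalence.from T-∧ (vb , T-not⁺ (v∉K ∘ member⇒∈))))

  -- The vertex p is exchanged for the apex q of the triangle over e, if there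
  -- is such a triangle and q has not been selected.  If p was the apex of
  -- another triangle, then q can take its place there, because the base of
  -- that triangle comes later than e, and q comes later than p.
  module _ {k : ℕ} (P : NormalPacking k)
    {e : Fin n × Fin n} {p : Fin n} {L : List (Fin n × Fin n)} {K : List (Fin n)}
    (served : Served L K P)
    (e-first : ∀ {f} → f ∈ arcs → f ∉ L → rank (proj₁ e) ≤ rank (proj₁ f))
    (p-candidate : Candidate e K p)
    (p-first : ∀ {v} → Candidate e K v → rank p ≤ rank v)
    where

    open NormalPacking P

    serve-next : Σ[ P′ ∈ NormalPacking k ] Served (e ∷ L) (p ∷ K) P′
    serve-next with any? (λ i → ¬? (T? (touched (apex i))) ×-dec ≡-dec _≟_ _≟_ (base i) e ×-dec ¬? (apex i ∈? K))
    ... | no none = P , λ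
      { i fa (here eq)  → there (decidable-stable (apex i ∈? K) λ a∉K → none (i , fa , eq , a∉K))
      ; i fa (there f∈) → there (served i fa f∈) }
    ... | yes (i₀ , fq , base≡e , q∉K) = P′ , served′
      where
      q = apex i₀
      τ = swap p q
      fp = proj₁ p-candidate
      p∉K = proj₂ (proj₂ (proj₂ p-candidate))

      q-candidate : Candidate e K q
      q-candidate = subst (λ f → Candidate f K q) base≡e
        (fq , Triangle.c⟶a (triangle i₀) , Triangle.a⟶b (triangle i₀) , q∉K)

      τ-touched : ∀ {v} → T (touched v) → τ v ≡ v
      τ-touched tv = swap-other (free≢touched fp tv ∘ sym) (free≢touched fq tv ∘ sym)

      same-base : ∀ {i} → base i ≡ e → i ≡ i₀
      same-base {i} eq with i ≟ i₀
      ... | yes i≡i₀ = i≡i₀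
      ... | no i≢i₀  = contradiction
        (there (here refl) , there (here (cong proj₁ (trans eq (sym base≡e))))) (disjoint i≢i₀)

      same-apex : ∀ {i} → apex i ≡ q → i ≡ i₀
      same-apex {i} eq with i ≟ i₀
      ... | yes i≡i₀ = i≡i₀
      ... | no i≢i₀  = contradiction (here refl , here eq) (disjoint i≢i₀)

      Joins : Fin n → Fin n × Fin n → Set
      Joins v (b , c) = c ⟶ v × v ⟶ b

      q-replaces-p : ∀ i → apex i ≡ p → Joins q (base i)
      q-replaces-p i refl = c⟶q , q⟶b
        where
        open Triangle (triangle i)
        open Normal (normal i)
        q⟶e = proj₁ (proj₂ (proj₂ q-candidate))
        -- The base of this triangle is not in `L`: otherwise `served` would put its apex `p` into
        -- `K`.
        e≤f : rank (proj₁ e) ≤ rank b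
        e≤f = e-first (bc∈arcs fp) (p∉K ∘ served i fp)

        q⟶b : q ⟶ b
        -- Otherwise `b ⟶ q`, and `rank q < rank (proj₁ e) ≤ rank b ≤ rank q`.
        q⟶b with T? (arc q b)
        ... | yes q⟶b = q⟶b
        ... | no ¬q⟶b = contradiction
          (<-≤-trans (free⟶⇒rank< fq q⟶e) (≤-trans e≤f (⟶free⇒rank≤ fq (connected (free≢touched fq b-touched) ¬q⟶b))))
          (<-irrefl refl)

        c⟶q : c ⟶ q
        -- Otherwise `q ⟶ c`, and `rank q < rank c ≤ rank p ≤ rank q`, the last because `q` is a
        -- candidate too.
        c⟶q with T? (arc c q)
        ... | yes c⟶q = c⟶q
        ... | no ¬c⟶q = contradiction
          (<-≤-trans (free⟶⇒rank< fq (connected (free≢touched fq c-touched ∘ sym) ¬c⟶q))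
            (≤-trans (⟶free⇒rank≤ fp c⟶a) (p-first q-candidate)))
          (<-irrefl refl)

      joins : ∀ i → Joins (τ (apex i)) (base i)
      joins i with apex i ≟ p | apex i ≟ q
      ... | yes a≡p | _       = q-replaces-p i a≡p
      ... | no _    | yes a≡q = subst (Joins p) (sym (trans (cong base (same-apex a≡q)) base≡e))
        (proj₁ (proj₂ p-candidate) , proj₁ (proj₂ (proj₂ p-candidate)))
      ... | no _    | no _    = Triangle.c⟶a (triangle i) , Triangle.a⟶b (triangle i)

      τ-free : ∀ v → Free (τ v) → Free v
      τ-free v fτv tv = fτv (subst (T ∘ touched) (sym (τ-touched {v} tv)) tv)

      triangle′ : Fin k → Triangle 𝒯
      triangle′ i = record
        { a = τ (apex i) ; b = proj₁ (base i) ; c = proj₂ (base i)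
        ; a⟶b = proj₂ (joins i) ; b⟶c = Triangle.b⟶c (triangle i) ; c⟶a = proj₁ (joins i) }

      -- As `τ` is an involution fixing all touched vertices, it maps a common vertex of two new
      -- triangles to a common vertex of the old ones.
      swap-back : ∀ i {v} → v ∈ Triangle.vertices (triangle′ i) → τ v ∈ Triangle.vertices (triangle i)
      swap-back i (here refl)                 = here (swap-involutive p q (apex i))
      swap-back i (there (here refl))         = there (here (τ-touched (Normal.b-touched (normal i))))
      swap-back i (there (there (here refl))) = there (there (here (τ-touched (Normal.c-touched (normal i)))))

      P′ : NormalPacking k
      P′ = record
        { triangle = triangle′
        ; disjoint = λ {i} {j} i≢j (v∈i , v∈j) → disjoint i≢j (swap-back i v∈i , swap-back j v∈j)
        ; normal   = λ i → record
          { b-touched = Normal.b-touched (normal i)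
          ; c-touched = Normal.c-touched (normal i)
          ; bc∈arcs   = λ fa → Normal.bc∈arcs (normal i) (τ-free (apex i) fa) }
        }

      served′ : Served (e ∷ L) (p ∷ K) P′
      served′ i fa (here eq)  = here (trans (cong (τ ∘ apex) (same-base eq)) (swap-q p q))
      -- An apex in `K` is not moved, since neither `p` nor `q` is in `K`.
      served′ i fa (there f∈) = there (subst (_∈ K) (sym (swap-other
        (λ a≡p → p∉K (subst (_∈ K) a≡p a∈K)) (λ a≡q → q∉K (subst (_∈ K) a≡q a∈K)))) a∈K)
        where a∈K = served i (τ-free (apex i) fa) f∈

  -- Induction that treats the tail of `L` first, as `selectFor` does. The last hypothesis supplies
  -- the comparison of ranks in the exchange; it passes to the tail because `L` is sorted with the
  -- latest arc first.
  serve : ∀ {k} (P : NormalPacking k) L →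
    AllPairs (λ e f → rank (proj₁ f) ≤ rank (proj₁ e)) L →
    (∀ {e f} → e ∈ L → f ∈ arcs → f ∉ L → rank (proj₁ e) ≤ rank (proj₁ f)) →
    Σ[ P′ ∈ NormalPacking k ] Served L (selectFor L) P′
  serve P []      _           _       = P , λ _ _ ()
  serve P (e ∷ L) (e≥L ∷ L-sorted) initial = step (candidates e (selectFor L)) refl
    where
    later : ∀ {e′ f} → e′ ∈ e ∷ L → f ∈ arcs → f ∉ L → rank (proj₁ e′) ≤ rank (proj₁ f)
    later {f = f} e′∈ f∈ f∉L with ≡-dec _≟_ _≟_ f e | e′∈
    ... | yes refl | here refl  = ≤-refl
    ... | yes refl | there e′∈L = All.lookup e≥L e′∈L
    ... | no f≢e   | _          = initial e′∈ f∈ λ { (here f≡e) → f≢e f≡e ; (there f∈L) → f∉L f∈L }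

    ih = serve P L L-sorted (later ∘ there)
    P₁ = proj₁ ih
    K = selectFor L

    candidates-sorted : AllPairs (λ p q → rank p ≤ rank q) (candidates e K)
    candidates-sorted = AllPairsₚ.filter⁺ (T? ∘ _) points-sorted

    step : ∀ ps → candidates e K ≡ ps → Σ[ P′ ∈ NormalPacking _ ] Served (e ∷ L) (take 1 ps ++ K) P′
    -- With no candidate left, a free apex over `e` must already be in `K`.
    step [] eq = P₁ , λ
      { i fa (here base≡e) → decidable-stable (_ ∈? K) λ a∉K →
          contradiction (subst (NormalPacking.apex P₁ i ∈_) eq (∈-candidates⁺ (subst (λ f → Candidate f K (NormalPacking.apex P₁ i)) base≡e
            (fa , Triangle.c⟶a (NormalPacking.triangle P₁ i) , Triangle.a⟶b (NormalPacking.triangle P₁ i) , a∉K)))) λ ()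
      ; i fa (there f∈)  → proj₂ ih i fa f∈ }
    -- The candidates are sorted by rank, so their head `p` has the least rank.
    step (p ∷ ps) eq = serve-next P₁ (proj₂ ih) (later (here refl))
      (∈-candidates⁻ (subst (p ∈_) (sym eq) (here refl)))
      λ {v} cv → first (subst (AllPairs _) eq candidates-sorted) (subst (v ∈_) eq (∈-candidates⁺ cv))
      where
      first : ∀ {v} → AllPairs (λ p q → rank p ≤ rank q) (p ∷ ps) → v ∈ p ∷ ps → rank p ≤ rank v
      first _         (here refl) = ≤-refl
      first (p≤ ∷ _) (there v∈)  = All.lookup p≤ v∈

  Keeps : ∀ {k} → NormalPacking k → Set
  Keeps P = ∀ i → Triangle.vertices (NormalPacking.triangle P i) ⊆ kept

  -- Once all jobs are served, every vertex of the packing is touched or selected: a free apex has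
  -- its base among the jobs.
  keep : ∀ {k} → NormalPacking k → Σ[ P ∈ NormalPacking k ] Keeps P
  -- All of `arcs` occurs in `jobs`, so no arc remains outside to compare with.
  keep P with serve P jobs jobs-sorted (λ _ f∈ f∉ → contradiction (∈-sort⁺ _ f∈) f∉)
  ... | P′ , served = P′ , keeps
    where
    open NormalPacking P′
    ∈-kept : ∀ v → T (touched v) ⊎ v ∈ selected → v ∈ kept
    ∈-kept v v∈ = ∈-filterᵇ⁺ (λ v → touched v ∨ member v selected) (∈-allFin v)
      (Equivalence.from T-∨ ([ inj₁ , inj₂ ∘ ∈⇒member ]′ v∈))
    apex-kept : ∀ i → Dec (T (touched (apex i))) → apex i ∈ kept
    apex-kept i (yes ta) = ∈-kept (apex i) (inj₁ ta)
    apex-kept i (no fa)  = ∈-kept (apex i) (inj₂ (served i fa (∈-sort⁺ _ (Normal.bc∈arcs (normal i) fa))))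
    keeps : Keeps P′
    keeps i (here refl)                 = apex-kept i (T? (touched (apex i)))
    keeps i (there (here refl))         = ∈-kept _ (inj₁ (Normal.b-touched (normal i)))
    keeps i (there (there (here refl))) = ∈-kept _ (inj₁ (Normal.c-touched (normal i)))

  -- The number of kept vertices

  kept-unique : Unique kept
  kept-unique = Uniqueₚ.filter⁺ (T? ∘ _) (Uniqueₚ.allFin⁺ n)

  length-selected : length selected ≤ length arcs
  length-selected = subst (length selected ≤_) (length-sort _ arcs) (length-selectFor jobs)
    where
    take₁-length : ∀ (xs ys : List (Fin n)) → length (take 1 xs ++ ys) ≤ 1 + length ys
    take₁-length []       ys = n≤1+n _
    take₁-length (x ∷ xs) ys = ≤-refl
    length-selectFor : ∀ L → length (selectFor L) ≤ length L
    length-selectFor []      = z≤n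
    length-selectFor (e ∷ L) = ≤-trans (take₁-length (candidates e (selectFor L)) (selectFor L)) (s≤s (length-selectFor L))

  -- The three summands are for the tails, the heads and the selected vertices, of which each arc
  -- contributes at most one.
  length-kept : length kept ≤ 3 * length arcs
  length-kept = begin
    length kept ≤⟨ length-Unique-⊆ kept-unique cover ⟩
    length (map proj₁ arcs ++ map proj₂ arcs ++ selected)
      ≡⟨ trans (length-++ (map proj₁ arcs)) (cong₂ _+_ (length-map proj₁ arcs)
           (trans (length-++ (map proj₂ arcs)) (cong (_+ length selected) (length-map proj₂ arcs)))) ⟩
    m + (m + length selected) ≤⟨ +-monoʳ-≤ m (+-monoʳ-≤ m (≤-trans length-selected (≤-reflexive (sym (+-identityʳ m))))) ⟩
    3 * m ∎
    where
    open ≤-Reasoning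
    m = length arcs
    cover-touched : ∀ {v} → (∃[ e ] e ∈ arcs × T (does (v ≟ proj₁ e) ∨ does (v ≟ proj₂ e))) →
      v ∈ map proj₁ arcs ++ map proj₂ arcs ++ selected
    cover-touched {v} (e , e∈ , test) with Equivalence.to (T-∨ {does (v ≟ proj₁ e)}) test
    ... | inj₁ v≡ = ∈-++⁺ˡ (subst (_∈ map proj₁ arcs) (sym (T-does⁻ (v ≟ proj₁ e) v≡)) (∈-map⁺ proj₁ e∈))
    ... | inj₂ v≡ = ∈-++⁺ʳ (map proj₁ arcs) (∈-++⁺ˡ (subst (_∈ map proj₂ arcs) (sym (T-does⁻ (v ≟ proj₂ e) v≡)) (∈-map⁺ proj₂ e∈)))
    cover : kept ⊆ map proj₁ arcs ++ map proj₂ arcs ++ selected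
    cover {v} v∈ with Equivalence.to (T-∨ {touched v}) (proj₂ (∈-filterᵇ⁻ (λ v → touched v ∨ member v selected) {xs = allFin n} v∈))
    ... | inj₁ tv = cover-touched (find (any⁻ (λ e → does (v ≟ proj₁ e) ∨ does (v ≟ proj₂ e)) arcs tv))
    ... | inj₂ sv = ∈-++⁺ʳ (map proj₁ arcs) (∈-++⁺ʳ (map proj₂ arcs) (member⇒∈ sv))

-- The kernel

-- Uniqueness makes `lookup K` injective, as trichotomy requires when the two entries are equal.
induced : ∀ {n} → Tournament n → (K : List (Fin n)) → Unique K → Tournament (length K)
induced 𝒯 K unique = record
  { arc     = λ i j → arc (lookup K i) (lookup K j)
  ; compare = λ i j → restrict (compare (lookup K i) (lookup K j))
  }
  where
  open Tournament 𝒯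
  restrict : ∀ {i j} → Tri (lookup K i ⟶ lookup K j) (lookup K i ≡ lookup K j) (lookup K j ⟶ lookup K i) →
             Tri (lookup K i ⟶ lookup K j) (i ≡ j) (lookup K j ⟶ lookup K i)
  restrict (tri< a ¬b ¬c) = tri< a (¬b ∘ cong (lookup K)) ¬c
  restrict (tri≈ ¬a b ¬c) = tri≈ ¬a (lookup-injective unique b) ¬c
  restrict (tri> ¬a ¬b c) = tri> ¬a (¬b ∘ cong (lookup K)) c

AllPairs-lookup : ∀ {A : Set} {R : A → A → Set} → Symmetric R → ∀ {xs} → AllPairs R xs →
  ∀ {i j} → i ≢ j → R (lookup xs i) (lookup xs j)
AllPairs-lookup sym (Rx ∷ _) {zero}  {zero}  i≢j = contradiction refl i≢j
AllPairs-lookup sym (Rx ∷ _) {zero}  {suc j} i≢j = All.lookup Rx (∈-lookup j)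
AllPairs-lookup sym (Rx ∷ _) {suc i} {zero}  i≢j = sym (All.lookup Rx (∈-lookup i))
AllPairs-lookup sym (_ ∷ Rs) {suc i} {suc j} i≢j = AllPairs-lookup sym Rs (i≢j ∘ cong suc)

clamp-small : ∀ {A : Set} (xs : List A) z → length (digits z) ≤ length xs → clamp xs z ≡ z
clamp-small xs z le with length (digits z) ≤ᵇ length xs | ≤⇒≤ᵇ le
... | true | _ = refl

-- The replacement value is negative, so the length of a packing never equals it.
clamp-natural : ∀ {A : Set} (xs : List A) z {m} → pos m ≡ clamp xs z → pos m ≡ z
clamp-natural xs z eq with length (digits z) ≤ᵇ length xs
... | true  = eq
... | false = contradiction eq λ ()

-- The digits of bijective base 2 are 1 and 2, so each of them adds at least one to the value.
length-bits : ∀ b → length (bits b) ≤ toℕᵇ b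
length-bits 0ᵇ       = z≤n
length-bits 1+[2 b ] = s≤s (≤-trans (length-bits b) (m≤m+n _ _))
length-bits 2[1+ b ] = ≤-trans (s≤s (length-bits b)) (m≤m+n _ _)

length-digits : ∀ m → length (digits (pos m)) ≤ m
length-digits m = ≤-trans (length-bits (fromℕ m)) (≤-reflexive (toℕ-fromℕ m))

size-list≤ : ∀ {A : Set} (e : A → Tree) {B} → (∀ x → size (e x) ≤ B) → ∀ xs →
  size (encodeList e xs) ≤ 1 + length xs * (1 + B)
size-list≤ e e≤ []       = ≤-refl
size-list≤ e {B} e≤ (x ∷ xs) = s≤s (≤-trans (+-mono-≤ (e≤ x) (size-list≤ e e≤ xs)) (≤-reflexive (+-suc B _)))

-- The constant 5 is made up of the root, at most 3 for the sign and 1 for the final leaf; a digit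
-- takes at most 3 and its list node 1.
size-integer≤ : ∀ z → size (encodeℤ z) ≤ 5 + length (digits z) * 4
size-integer≤ (pos m)  rewrite encode-bits (fromℕ m) = s≤s (+-mono-≤ {1} {3} (s≤s z≤n) (size-list≤ encodeBool size-bool≤ (bits (fromℕ m))))
size-integer≤ -[1+ m ] rewrite encode-bits (fromℕ m) = s≤s (+-mono-≤ {3} {3} ≤-refl (size-list≤ encodeBool size-bool≤ (bits (fromℕ m))))

size-clamp≤ : ∀ {A : Set} (xs : List A) z → size (encodeℤ (clamp xs z)) ≤ 5 + length xs * 4
size-clamp≤ xs z with length (digits z) ≤ᵇ length xs in le
... | true  = ≤-trans (size-integer≤ z) (+-monoʳ-≤ 5 (*-monoˡ-≤ 4 (≤ᵇ⇒≤ (length (digits z)) (length xs) (subst T (sym le) _))))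
... | false = m≤m+n 5 _

encodeList-lookup : ∀ {A : Set} (e : A → Tree) xs →
  encodeList e xs ≡ encodeList (e ∘ lookup xs) (allFin (length xs))
encodeList-lookup e xs = trans (cong (encodeList e) (sym (trans (map-tabulate id (lookup xs)) (tabulate-lookup xs))))
  (encodeList-map e (lookup xs) (allFin (length xs)))

module _ (I : InstanceWithFAS) where
  open InstanceWithFAS I
  open Instance base
  open FeedbackArcSet fas using (arcs)
  open Tournament tournament using (arc)
  open Selection arc arcs using (kept)
  open Packings tournament fas

  kernel : Instance
  kernel = record
    { order      = length kept
    ; tournament = induced tournament kept kept-unique
    ; target     = clamp kept target
    }

  -- The program lists matrix entries by vertices in `kept`, while the kernel is indexed by
  -- positions in `kept`; `lookup` relates the two.
  encode-kernel : enc (list (list bool) ⊗ integer) order (map (λ i → map (arc i) kept) kept , clamp kept target)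
                  ≡ encodeInstance kernel
  encode-kernel = cong (λ t → node t (encodeℤ (clamp kept target))) (trans (encodeList-map (encodeList encodeBool) (λ i → map (arc i) kept) kept)
    (trans (encodeList-lookup _ kept) (encodeList-cong (λ i → trans (encodeList-map encodeBool (arc (lookup kept i)) kept) (encodeList-lookup _ kept))
      (allFin (length kept)))))

  -- The matrix is quadratic in the order, and clamping keeps the target linear in it.
  size-kernel≤ : let k = length kept in
    size (encodeInstance kernel) ≤ 1 + (1 + k * (1 + (1 + k * 4))) + (5 + k * 4)
  size-kernel≤ = s≤s (+-mono-≤ (matrix≤ (Tournament.arc (Instance.tournament kernel))) (size-clamp≤ kept target))
    where
    all≤ : ∀ {A : Set} (e : A → Tree) {B k} (xs : List A) → length xs ≡ k → (∀ x → size (e x) ≤ B) →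
      size (encodeList e xs) ≤ 1 + k * (1 + B)
    all≤ e xs refl e≤ = size-list≤ e e≤ xs
    matrix≤ : ∀ {k} (f : Fin k → Fin k → Bool) →
      size (encodeList (λ i → encodeList (λ j → encodeBool (f i j)) (allFin k)) (allFin k)) ≤ 1 + k * (1 + (1 + k * 4))
    matrix≤ {k} f = all≤ _ (allFin k) (length-tabulate {n = k} id) λ i → all≤ _ (allFin k) (length-tabulate {n = k} id) λ j → size-bool≤ (f i j)

  private
    lift : Triangle (induced tournament kept kept-unique) → Triangle tournament
    lift t = record { a = lookup kept a ; b = lookup kept b ; c = lookup kept c ; a⟶b = a⟶b ; b⟶c = b⟶c ; c⟶a = c⟶a }
      where open Triangle t

    lift-disjoint : ∀ {t u} → VertexDisjoint _ t u → VertexDisjoint _ (lift t) (lift u)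
    lift-disjoint {t} {u} d (v∈t , v∈u)
      with ∈-map⁻ (lookup kept) {xs = Triangle.vertices t} v∈t | ∈-map⁻ (lookup kept) {xs = Triangle.vertices u} v∈u
    ... | i , i∈t , v≡i | j , j∈u , v≡j =
      d (i∈t , subst (_∈ Triangle.vertices u) (lookup-injective kept-unique (trans (sym v≡j) v≡i)) j∈u)

    restrict : (t : Triangle tournament) → Triangle.vertices t ⊆ kept →
      Σ[ t′ ∈ Triangle (induced tournament kept kept-unique) ] map (lookup kept) (Triangle.vertices t′) ≡ Triangle.vertices t
    restrict t t⊆ = go (lookup-index a∈) (lookup-index b∈) (lookup-index c∈) a⟶b b⟶c c⟶a
      where
      open Triangle t
      open Tournament tournament using (_⟶_)
      a∈ = t⊆ (here refl)
      b∈ = t⊆ (there (here refl))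
      c∈ = t⊆ (there (there (here refl)))
      go : ∀ {a b c i j k} → a ≡ lookup kept i → b ≡ lookup kept j → c ≡ lookup kept k → a ⟶ b → b ⟶ c → c ⟶ a →
        Σ[ t′ ∈ Triangle (induced tournament kept kept-unique) ] map (lookup kept) (Triangle.vertices t′) ≡ a ∷ b ∷ c ∷ []
      go {i = i} {j} {k} refl refl refl a⟶b b⟶c c⟶a =
        record { a = i ; b = j ; c = k ; a⟶b = a⟶b ; b⟶c = b⟶c ; c⟶a = c⟶a } , refl

  kernel⇒base : Positive kernel → Positive base
  kernel⇒base (ts , disjoint , eq) = map lift ts , AllPairsₚ.map⁺ (AllPairs.map (λ {t} {u} → lift-disjoint {t} {u}) disjoint) ,
    trans (cong pos (length-map lift ts)) (clamp-natural kept target eq)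

  -- The packing is normalized, exchanged for one inside `kept` and restricted to it. Its size is
  -- then at most the number of kept vertices, so a target that it reaches is not clamped.
  base⇒kernel : Positive base → Positive kernel
  base⇒kernel (ts , disjoint , eq) = tabulate (proj₁ ∘ restricted) , AllPairsₚ.tabulate⁺ restricted-disjoint ,
    trans (cong pos (length-tabulate (proj₁ ∘ restricted))) (trans eq (sym (clamp-small kept target
      (subst (λ z → length (digits z) ≤ length kept) eq (≤-trans (length-digits (length ts)) enough)))))
    where
    normalized : NormalPacking (length ts)
    normalized = record
      { triangle = λ i → proj₁ (normalize (lookup ts i))
      ; disjoint = λ {i} {j} i≢j (v∈i , v∈j) → AllPairs-lookup {R = VertexDisjoint tournament} (λ d (v∈t , v∈u) → d (v∈u , v∈t)) disjoint i≢j
          (proj₂ (proj₂ (normalize (lookup ts i))) v∈i , proj₂ (proj₂ (normalize (lookup ts j))) v∈j)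
      ; normal   = λ i → proj₁ (proj₂ (normalize (lookup ts i)))
      }
    P = proj₁ (keep normalized)
    keeps = proj₂ (keep normalized)
    open NormalPacking P using (triangle) renaming (disjoint to P-disjoint)

    restricted : ∀ i → Σ[ t′ ∈ Triangle (induced tournament kept kept-unique) ]
      map (lookup kept) (Triangle.vertices t′) ≡ Triangle.vertices (triangle i)
    restricted i = restrict (triangle i) (keeps i)

    restricted-disjoint : ∀ {i j} → i ≢ j → VertexDisjoint _ (proj₁ (restricted i)) (proj₁ (restricted j))
    restricted-disjoint {i} {j} i≢j {v} (v∈i , v∈j) = P-disjoint i≢j
      ( subst (lookup kept v ∈_) (proj₂ (restricted i)) (∈-map⁺ (lookup kept) v∈i)
      , subst (lookup kept v ∈_) (proj₂ (restricted j)) (∈-map⁺ (lookup kept) v∈j))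

    enough : length ts ≤ length kept
    -- Disjoint triangles have different vertices `a`.
    enough = injective⇒≤ {f = λ i → Triangle.a (proj₁ (restricted i))} λ {i} {j} eq →
      same (i ≟ j) eq
      where
      same : ∀ {i j} → Dec (i ≡ j) → Triangle.a (proj₁ (restricted i)) ≡ Triangle.a (proj₁ (restricted j)) → i ≡ j
      same (yes i≡j) _ = i≡j
      same (no i≢j) eq = contradiction (here refl , here eq) (restricted-disjoint i≢j)

theorem11 : Σ[ kernel ∈ (InstanceWithFAS → Instance) ]
    PolynomialTime encodeInstanceWithFAS encodeInstance kernel ×
    (∀ I → Positive (kernel I) ⇔ Positive (InstanceWithFAS.base I)) ×
    (size ∘ encodeInstance ∘ kernel) IsPolynomiallyBoundedIn InstanceWithFAS.parameter ×
    (∃[ c ] ∀ I → Instance.order (kernel I) ≤ c * InstanceWithFAS.parameter I)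
theorem11 = kernel ,
  (prog kernelᵀ , (λ I → Runs.cost (runs-kernel I)) , (λ I → Runs.exec (runs-kernel I)) ,
    poly-bounded (bound kernelᵀ) _ _ (λ I → Runs.cost≤ (runs-kernel I))) ,
  (λ I → mk⇔ (kernel⇒base I) (base⇒kernel I)) ,
  poly-bounded size-bound _ _ (λ I → ≤-trans (size-kernel≤ I) (eval-mono kernel-size (order≤ I))) ,
  3 , order≤
  where
  runs-kernel : ∀ I → Runs (prog kernelᵀ) (bound kernelᵀ) (encodeInstanceWithFAS I) (encodeInstance (kernel I))
  runs-kernel I = subst (Runs _ _ _) (encode-kernel I) (run kernelᵀ order ((Tournament.arc tournament , target) , FeedbackArcSet.arcs fas))
    where
    open InstanceWithFAS I
    open Instance base
  order≤ : ∀ I → Instance.order (kernel I) ≤ 3 * InstanceWithFAS.parameter I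
  order≤ I = Packings.length-kept _ (InstanceWithFAS.fas I)
  kernel-size : Poly
  kernel-size = con 1 ⊕ (con 1 ⊕ var ⊛ (con 1 ⊕ (con 1 ⊕ var ⊛ con 4))) ⊕ (con 5 ⊕ var ⊛ con 4)
  size-bound : Poly
  -- `kernel-size` bounds the size in terms of the order, which is at most three times the
  -- parameter.
  size-bound = kernel-size ∘ₚ (con 3 ⊛ var)
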